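{- Let $N\ge 3$ and $N=rq$ with positive integers $r,q$, and let $R$ be a set of $r$ rim vertices of the wheel graph $W_{N+1}$ chosen at equal intervals, i.e. all of whose cyclic intervals satisfy $d_1=d_2=\cdots=d_r=q$. Then $$\mathcal F_{W_{N+1}}(R)=\tau(W_{N+1}/R)=r\left(L_{2q}-2\right)F_{2q}^{\,r-1}.$$
   Context: The wheel graph $W_{N+1}$ ($N\ge3$) has vertex set $\{c,v_1,\ldots,v_N\}$ and edges $\{v_i,v_{i+1}\}$ (indices modulo $N$) and $\{c,v_i\}$ for $1\le i\le N$; $c$ is the central vertex and the $v_i$ are the rim vertices. For a set $R=\{v_{a_1},\ldots,v_{a_r}\}$ of rim vertices with $1\le a_1<\cdots<a_r\le N$, the cyclic intervals are $d_i=a_{i+1}-a_i$ for $1\le i\le r-1$ and $d_r=a_1+N-a_r$. For a finite connected graph $G$ and $\varnothing\ne R\subseteq V(G)$, a rooted spanning forest of $G$ with root set $R$ is a spanning forest (an acyclic subgraph containing all vertices of $G$) in which each connected component contains exactly one vertex of $R$; $\mathcal F_G(R)$ denotes the number of such forests. $G/R$ is the multigraph obtained from $G$ by identifying all vertices of $R$ into a single vertex, keeping multiple edges with their multiplicities and deleting loops. $\tau(H)$ is the number of spanning trees of $H$, where parallel edges are regarded as distinct. Fibonacci numbers: $F_0=0$, $F_1=1$, $F_{n+2}=F_{n+1}+F_n$. Lucas numbers: $L_0=2$, $L_1=1$, $L_{n+2}=L_{n+1}+L_n$. -}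

module Defs where

open import Data.Nat.Base using (ℕ; zero; suc; _+_; _∸_; _≤_; s≤s)
open import Data.Nat.DivMod using (_mod_)
open import Data.Bool.Base using (Bool; false; true)
open import Data.Empty using (⊥)
open import Data.Fin.Base using (Fin; zero; suc; toℕ; fromℕ; inject₁)
import Data.Fin.Properties as Fin
open import Data.Fin.Relation.Unary.Top using (view; ‵fromℕ; ‵inject₁)
open import Data.List.Base
  using (List; []; _∷_; _++_; map; filter; length; lookup; allFin; tabulate; cartesianProduct; cartesianProductWith)
import Data.List.Properties as List
open import Data.List.Membership.Propositional using (_∈_; lose; find)
open import Data.List.Membership.Propositional.Properties
  using (∈-allFin; ∈-cartesianProduct⁺; ∈-cartesianProductWith⁺; ∈-map⁺; ∈-filter⁺; ∈-lookup)
import Data.List.Membership.DecPropositional as DecMembership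
open import Data.List.Relation.Unary.All as All using (All; []; _∷_)
import Data.List.Relation.Unary.All.Properties as All
open import Data.List.Relation.Unary.AllPairs using (_∷_)
open import Data.List.Relation.Unary.Any using (here; there; any?)
open import Data.List.Relation.Unary.Unique.Propositional using (Unique)
import Data.List.Relation.Unary.Unique.DecPropositional as DecUnique
open import Data.Maybe.Base using (Maybe; just; nothing)
import Data.Maybe.Properties as Maybe
open import Data.Product using (_×_; _,_; proj₁; proj₂; ∃; ∃!)
open import Data.Sum.Base using (_⊎_; inj₁; inj₂)
open import Function.Base using (_∘_)
open import Relation.Binary.Construct.Closure.Equivalence as EqClosure using (EqClosure)
open import Relation.Binary.Construct.Closure.ReflexiveTransitive using (ε; _◅_; _◅◅_)
open import Relation.Binary.Construct.Closure.Symmetric using (fwd; bwd)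
open import Relation.Binary.Definitions using (DecidableEquality; Decidable)
open import Relation.Binary.PropositionalEquality using (_≡_; refl; sym; cong; subst)
open import Relation.Nullary using (¬_; Dec; yes; no; ¬?; contradiction)
open import Relation.Nullary.Decidable using (map′; _×-dec_; _⊎-dec_; _→-dec_)

fib : ℕ → ℕ
fib 0 = 0
fib 1 = 1
fib (suc (suc n)) = fib (suc n) + fib n

lucas : ℕ → ℕ
lucas 0 = 2
lucas 1 = 1
lucas (suc (suc n)) = lucas (suc n) + lucas n

-- The vertex set is the set of members of `vertices`.  Each position in
-- `edges` is a separate edge, so parallel edges are repeated entries.  The
-- order of the two endpoints is irrelevant: everything below that refers to
-- adjacency allows an edge to be traversed in both directions.
record Multigraph : Set₁ where
  infix 4 _≟_
  field
    Vertex      : Set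
    _≟_         : DecidableEquality Vertex
    vertices    : List Vertex
    edges       : List (Vertex × Vertex)
    endpoints-∈ : All (λ e → proj₁ e ∈ vertices × proj₂ e ∈ vertices) edges

-- All ways of selecting entries by position: 2 ^ length xs lists.  Applied to
-- `edges G` this enumerates every set of edges exactly once, with parallel
-- edges counted as distinct.
sublists : {A : Set} → List A → List (List A)
sublists []       = [] ∷ []
sublists (x ∷ xs) = map (x ∷_) (sublists xs) ++ sublists xs

-- For the subgraph with edge list es: joined by a walk in es, i.e. in the same
-- connected component.
Connected : {V : Set} → List (V × V) → V → V → Set
Connected es = EqClosure (λ u v → (u , v) ∈ es)

module _ {V : Set} (es : List (V × V)) where

  -- An edge, given by its position, with a direction of travel.
  Dart : Set
  Dart = Fin (length es) × Bool

  source : Dart → V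
  source (e , false) = proj₁ (lookup es e)
  source (e , true)  = proj₂ (lookup es e)

  target : Dart → V
  target (e , false) = proj₂ (lookup es e)
  target (e , true)  = proj₁ (lookup es e)

  IsWalk : V → List Dart → V → Set
  IsWalk u []       w = u ≡ w
  IsWalk u (d ∷ ds) w = u ≡ source d × IsWalk (target d) ds w

  -- Loops are cycles of length one and pairs of parallel edges give cycles of
  -- length two; distinctness of the edges excludes going back and forth along
  -- a single edge.
  IsCycle : List Dart → Set
  IsCycle []          = ⊥
  IsCycle ds@(d ∷ _) =
    IsWalk (source d) ds (source d) × Unique (map proj₁ ds) × Unique (map source ds)

  Acyclic : Set
  Acyclic = ∀ ds → ¬ IsCycle ds

module _ (G : Multigraph) where
  open Multigraph G

  IsSpanningTree : List (Vertex × Vertex) → Set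
  IsSpanningTree es =
    Acyclic es × All (λ u → All (λ v → Connected es u v) vertices) vertices

  -- R is read as a set.  The component of each vertex v contains exactly one
  -- member of R.
  IsRootedSpanningForest : List Vertex → List (Vertex × Vertex) → Set
  IsRootedSpanningForest R es =
    Acyclic es × All (λ v → ∃! _≡_ (λ r → r ∈ R × Connected es v r)) vertices

module _ {V : Set} (_≟_ : DecidableEquality V) where

  private
    Conn : List (V × V) → V → V → Set
    Conn = Connected

    conn-sym : ∀ {es x y} → Conn es x y → Conn es y x
    conn-sym = EqClosure.symmetric _

    weaken : ∀ {e es x y} → Conn es x y → Conn (e ∷ es) x y
    weaken = EqClosure.map there

    Via : V × V → List (V × V) → V → V → Set
    Via (a , b) es x y =
      Conn es x y ⊎ (Conn es x a × Conn es b y) ⊎ (Conn es x b × Conn es a y)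

    via⇒conn : ∀ {a b es x y} → Via (a , b) es x y → Conn ((a , b) ∷ es) x y
    via⇒conn (inj₁ p)              = weaken p
    via⇒conn (inj₂ (inj₁ (p , q))) = weaken p ◅◅ fwd (here refl) ◅ weaken q
    via⇒conn (inj₂ (inj₂ (p , q))) = weaken p ◅◅ bwd (here refl) ◅ weaken q

    prepend : ∀ {a b es x y z} → Conn es x y → Via (a , b) es y z → Via (a , b) es x z
    prepend s (inj₁ p)              = inj₁ (s ◅◅ p)
    prepend s (inj₂ (inj₁ (p , q))) = inj₂ (inj₁ (s ◅◅ p , q))
    prepend s (inj₂ (inj₂ (p , q))) = inj₂ (inj₂ (s ◅◅ p , q))

    conn⇒via : ∀ {a b es x y} → Conn ((a , b) ∷ es) x y → Via (a , b) es x y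
    conn⇒via ε = inj₁ ε
    conn⇒via (fwd (there m) ◅ c) = prepend (fwd m ◅ ε) (conn⇒via c)
    conn⇒via (bwd (there m) ◅ c) = prepend (bwd m ◅ ε) (conn⇒via c)
    conn⇒via (fwd (here refl) ◅ c) with conn⇒via c
    ... | inj₁ p              = inj₂ (inj₁ (ε , p))
    ... | inj₂ (inj₁ (p , q)) = inj₂ (inj₁ (ε , q))
    ... | inj₂ (inj₂ (p , q)) = inj₁ q
    conn⇒via (bwd (here refl) ◅ c) with conn⇒via c
    ... | inj₁ p              = inj₂ (inj₂ (ε , p))
    ... | inj₂ (inj₁ (p , q)) = inj₁ q
    ... | inj₂ (inj₂ (p , q)) = inj₂ (inj₂ (ε , q))

  connected? : ∀ es → Decidable (Connected {V} es)
  connected? [] x y = map′ (λ { refl → ε }) from (x ≟ y)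
    where
    from : Conn [] x y → x ≡ y
    from ε            = refl
    from (fwd () ◅ _)
    from (bwd () ◅ _)
  connected? ((a , b) ∷ es) x y = map′ via⇒conn conn⇒via
    (connected? es x y
      ⊎-dec (connected? es x a ×-dec connected? es b y)
      ⊎-dec (connected? es x b ×-dec connected? es a y))

  isWalk? : ∀ es u ds w → Dec (IsWalk {V} es u ds w)
  isWalk? es u []       w = u ≟ w
  isWalk? es u (d ∷ ds) w = (u ≟ source es d) ×-dec isWalk? es (target es d) ds w

  isCycle? : ∀ es ds → Dec (IsCycle {V} es ds)
  isCycle? es []         = no λ ()
  isCycle? es ds@(d ∷ _) =
    isWalk? es (source es d) ds (source es d)
      ×-dec DecUnique.unique? Fin._≟_ (map proj₁ ds)
      ×-dec DecUnique.unique? _≟_ (map (source es) ds)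

  private
    listsUpTo : {A : Set} → List A → ℕ → List (List A)
    listsUpTo xs zero    = [] ∷ []
    listsUpTo xs (suc k) = [] ∷ cartesianProductWith _∷_ xs (listsUpTo xs k)

    ∈-listsUpTo : {A : Set} {xs : List A} → (∀ x → x ∈ xs) →
                  ∀ {k} ys → length ys ≤ k → ys ∈ listsUpTo xs k
    ∈-listsUpTo all {zero}  []       _       = here refl
    ∈-listsUpTo all {suc k} []       _       = here refl
    ∈-listsUpTo all {suc k} (y ∷ ys) (s≤s l) =
      there (∈-cartesianProductWith⁺ _∷_ (all y) (∈-listsUpTo all ys l))

    lookup-injective : {A : Set} {xs : List A} → Unique xs →
                       ∀ {i j} → lookup xs i ≡ lookup xs j → i ≡ j
    lookup-injective (_ ∷ _)  {zero}  {zero}  _  = refl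
    lookup-injective (p ∷ _)  {zero}  {suc j} eq = contradiction eq (All.lookup p (∈-lookup j))
    lookup-injective (p ∷ _)  {suc i} {zero}  eq = contradiction (sym eq) (All.lookup p (∈-lookup i))
    lookup-injective (_ ∷ ps) {suc i} {suc j} eq = cong suc (lookup-injective ps eq)

    cycle-length : ∀ es ds → IsCycle {V} es ds → length ds ≤ length es
    cycle-length es ds@(_ ∷ _) (_ , u , _) =
      subst (_≤ length es) (List.length-map proj₁ ds) (Fin.injective⇒≤ (lookup-injective u))

    darts : (es : List (V × V)) → List (Dart es)
    darts es = cartesianProduct (allFin (length es)) (false ∷ true ∷ [])

    ∈-darts : ∀ es (d : Dart es) → d ∈ darts es
    ∈-darts es (e , false) = ∈-cartesianProduct⁺ (∈-allFin e) (here refl)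
    ∈-darts es (e , true)  = ∈-cartesianProduct⁺ (∈-allFin e) (there (here refl))

  acyclic? : ∀ es → Dec (Acyclic {V} es)
  acyclic? es = map′ to from (All.all? (¬? ∘ isCycle? es) (listsUpTo (darts es) (length es)))
    where
    to : All (¬_ ∘ IsCycle es) (listsUpTo (darts es) (length es)) → Acyclic es
    to none ds c =
      All.lookup none (∈-listsUpTo (∈-darts es) ds (cycle-length es ds c)) c

    from : Acyclic es → All (¬_ ∘ IsCycle es) (listsUpTo (darts es) (length es))
    from ac = All.universal ac _

  uniqueRoot? : ∀ R es v → Dec (∃! _≡_ (λ r → r ∈ R × Connected {V} es v r))
  uniqueRoot? R es v = map′ (to ∘ find) (λ h → let _ , r∈R , o = from h in lose r∈R o)
    (any? (λ r → connected? es v r ×-dec All.all? (λ s → connected? es v s →-dec (r ≟ s)) R) R)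
    where
    OnlyRoot : V → Set
    OnlyRoot r = Conn es v r × All (λ s → Conn es v s → r ≡ s) R

    to : ∃ (λ r → r ∈ R × OnlyRoot r) → ∃! _≡_ (λ r → r ∈ R × Conn es v r)
    to (r , r∈R , c , u) = r , (r∈R , c) , λ { (s∈R , c′) → All.lookup u s∈R c′ }

    from : ∃! _≡_ (λ r → r ∈ R × Conn es v r) → ∃ (λ r → r ∈ R × OnlyRoot r)
    from (r , (r∈R , c) , u) = r , r∈R , c , All.tabulate (λ s∈R c′ → u (s∈R , c′))

module _ (G : Multigraph) where
  open Multigraph G

  isSpanningTree? : ∀ es → Dec (IsSpanningTree G es)
  isSpanningTree? es = acyclic? _≟_ es
    ×-dec All.all? (λ u → All.all? (connected? _≟_ es u) vertices) vertices

  isRootedSpanningForest? : ∀ R es → Dec (IsRootedSpanningForest G R es)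
  isRootedSpanningForest? R es = acyclic? _≟_ es
    ×-dec All.all? (uniqueRoot? _≟_ R es) vertices

τ : Multigraph → ℕ
τ G = length (filter (isSpanningTree? G) (sublists (Multigraph.edges G)))

𝓕 : (G : Multigraph) → List (Multigraph.Vertex G) → ℕ
𝓕 G R = length (filter (isRootedSpanningForest? G R) (sublists (Multigraph.edges G)))

module Identify (G : Multigraph) (R : List (Multigraph.Vertex G)) where
  open Multigraph G
  open DecMembership _≟_ using (_∈?_; _∉?_)

  -- `nothing` is the vertex obtained from R.
  collapse : Vertex → Maybe Vertex
  collapse v with v ∈? R
  ... | yes _ = nothing
  ... | no  _ = just v

  collapseEdge : Vertex × Vertex → Maybe Vertex × Maybe Vertex
  collapseEdge (u , v) = collapse u , collapse v

  _≟′_ : DecidableEquality (Maybe Vertex)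
  _≟′_ = Maybe.≡-dec _≟_

  vertices′ : List (Maybe Vertex)
  vertices′ = nothing ∷ map just (filter (_∉? R) vertices)

  edges′ : List (Maybe Vertex × Maybe Vertex)
  edges′ = filter (λ e → ¬? (proj₁ e ≟′ proj₂ e)) (map collapseEdge edges)

  collapse-∈ : ∀ {v} → v ∈ vertices → collapse v ∈ vertices′
  collapse-∈ {v} v∈ with v ∈? R
  ... | yes _  = here refl
  ... | no v∉R = there (∈-map⁺ just (∈-filter⁺ (_∉? R) v∈ v∉R))

infixl 7 _/_

_/_ : (G : Multigraph) → List (Multigraph.Vertex G) → Multigraph
G / R = record
  { Vertex      = Maybe (Multigraph.Vertex G)
  ; _≟_         = _≟′_
  ; vertices    = vertices′
  ; edges       = edges′
  ; endpoints-∈ = All.filter⁺ _ (All.map⁺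
      (All.map (λ { (p , q) → collapse-∈ p , collapse-∈ q }) (Multigraph.endpoints-∈ G)))
  }
  where open Identify G R

data WheelVertex (N : ℕ) : Set where
  centre : WheelVertex N
  rim    : Fin N → WheelVertex N

rim-injective : ∀ {N} {i j : Fin N} → rim i ≡ rim j → i ≡ j
rim-injective refl = refl

wheel-≟ : ∀ {N} → DecidableEquality (WheelVertex N)
wheel-≟ centre  centre  = yes refl
wheel-≟ centre  (rim _) = no λ ()
wheel-≟ (rim _) centre  = no λ ()
wheel-≟ (rim i) (rim j) = map′ (cong rim) rim-injective (i Fin.≟ j)

next : ∀ {N} → Fin N → Fin N
next {suc n} i = suc (toℕ i) mod suc n

-- The wheel with N rim vertices, so N + 1 vertices in all; `rim i` is
-- v_{i+1}.  For N ≥ 3 there are no loops and no parallel edges.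
wheel : ℕ → Multigraph
wheel N = record
  { Vertex      = WheelVertex N
  ; _≟_         = wheel-≟
  ; vertices    = vs
  ; edges       = tabulate (λ i → rim i , rim (next i)) ++ tabulate (λ i → centre , rim i)
  ; endpoints-∈ = All.++⁺
      (All.tabulate⁺ (λ i → rim-∈ i , rim-∈ (next i)))
      (All.tabulate⁺ (λ i → here refl , rim-∈ i))
  }
  where
  vs : List (WheelVertex N)
  vs = centre ∷ map rim (allFin N)

  rim-∈ : ∀ i → rim i ∈ vs
  rim-∈ i = there (∈-map⁺ rim (∈-allFin i))

-- Here a lists the positions on the rim in increasing order; the last
-- interval wraps around.
cyclicInterval : ∀ {N r} → (Fin r → Fin N) → Fin r → ℕ
cyclicInterval {N} {suc k} a i with view i
... | ‵inject₁ j = toℕ (a (suc j)) ∸ toℕ (a (inject₁ j))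
... | ‵fromℕ     = toℕ (a zero) + N ∸ toℕ (a (fromℕ k))

rimSet : ∀ {N r} → (Fin r → Fin N) → List (WheelVertex N)
rimSet a = tabulate (rim ∘ a)

{-# OPTIONS --safe #-}
module Submission where

-- Identifying the roots turns rooted forests into spanning trees: a forest on
-- G collapses to an acyclic subgraph of G / R exactly when no two roots are
-- joined in it.
--
-- Collapsing equally spaced roots of the wheel to a terminal z leaves r fans
-- glued in parallel between the hub c and z: in each, a path of q - 1 rim
-- vertices runs from z back to z, every one of them is joined to c, and the
-- root contributes one more edge c z.  Eliminating the rim vertices of a fan by
-- deletion-contraction gives F_2q forests separating c from z and L_2q - 2
-- trees joining them.  A spanning tree joins c to z in exactly one of the r
-- fans, hence r (L_2q - 2) F_2q ^ (r - 1).

open import Defs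
open import Data.Bool.Base using (true; false)
open import Data.Fin.Base using (Fin; zero; suc; _<_; toℕ; fromℕ<; inject₁)
import Data.Fin.Properties as Fin
open import Data.Fin.Relation.Unary.Top using (view-inject₁)
open import Data.List.Base
  using (List; []; _∷_; _++_; map; filter; length; replicate; applyUpTo; tabulate)
import Data.List.Properties as List
import Data.List.Membership.DecPropositional as DecMembership
open import Data.List.Membership.Propositional using (_∈_; _∉_)
open import Data.List.Membership.Propositional.Properties
  using ( ∈-map⁺; ∈-map⁻; ∈-lookup; ∈-allFin; ∈-++⁺ˡ; ∈-++⁺ʳ; ∈-++⁻; ∈-filter⁻
        ; ∈-applyUpTo⁺; ∈-applyUpTo⁻; ∈-tabulate⁺; ∈-tabulate⁻)
open import Data.List.Relation.Binary.Permutation.Propositional as Perm using (_↭_; ↭-sym; ↭-reflexive)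
import Data.List.Relation.Binary.Permutation.Propositional.Properties as Perm
open import Data.List.Relation.Unary.All as All using (All; []; _∷_)
import Data.List.Relation.Unary.All.Properties as All
open import Data.List.Relation.Unary.AllPairs using ([]; _∷_)
open import Data.List.Relation.Unary.Any using (here; there)
open import Data.List.Relation.Unary.Unique.Propositional using (Unique)
import Data.List.Relation.Unary.Unique.Propositional.Properties as Unique
open import Data.Maybe.Base using (Maybe; just; nothing)
open import Data.Nat.Base as ℕ using (ℕ; zero; suc; _+_; _*_; _∸_; _^_; _≤_; _%_; z≤n; s≤s; NonZero)
open import Data.Nat.DivMod as DivMod using (_mod_)
open import Data.Nat.Properties
  using ( *-suc; *-identityˡ; *-identityʳ; *-distribʳ-∸; *-monoˡ-<; *-monoˡ-≤; +-assoc; +-comm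
        ; +-suc; +-identityʳ; +-cancelˡ-≡; +-monoʳ-<; +-commutativeSemigroup; m≤m+n; m≤n+m
        ; m+n≮m; m+n∸m≡n; m∸n+n≡m; m≤n⇒m∸n≡0; [m+n]∸[m+o]≡n∸o; m≤n⇒∃[o]m+o≡n; m≤n⇒m<n∨m≡n
        ; ≤-refl; ≤-total; <⇒≢; <-trans; <-≤-trans; ≤-<-trans; suc-injective)
open import Data.Nat.Tactic.RingSolver using (solve-∀)
open import Data.Product as Product using (_×_; _,_; proj₁; proj₂; ∃; ∃!)
open import Data.Sum.Base as Sum using (_⊎_; inj₁; inj₂; [_,_]′)
open import Function.Base using (_∘_; id)
open import Relation.Binary.Construct.Closure.Equivalence as EqClosure using ()
open import Relation.Binary.Construct.Closure.ReflexiveTransitive using (ε; _◅_; _◅◅_)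
open import Relation.Binary.Construct.Closure.Symmetric using (fwd; bwd)
open import Relation.Binary.Definitions using (DecidableEquality; Monotonic₁)
open import Relation.Binary.PropositionalEquality
open import Relation.Nullary using (¬_; yes; no; does; ¬?; contradiction)
open import Relation.Nullary.Decidable using (_×-dec_)
open import Relation.Unary using (Decidable)
open import Algebra.Properties.CommutativeSemigroup +-commutativeSemigroup using (interchange)

-- `Acyclic` quantifies over dart lists, which behave badly under contraction. The way out is a
-- one-edge criterion: `(a , b) ∷ es` is acyclic exactly when `es` is acyclic and `a`, `b` lie in
-- different components of `es`. Once `acyclic-∷⁺`, `acyclic-tail` and `acyclic-head` provide it,
-- permuting, contracting and collapsing edges are all inductions on the edge list.
--
-- A graph is reduced to a vertex list, which matters only as a set, and an edge list, read by
-- position. Identifying vertices means applying a function to all endpoints while keeping loops and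
-- parallel edges, so edge sets before and after correspond one to one, and loops contribute no
-- tree.
--
-- The gluing is linear algebra. The part already built is seen through a pair (A, B): its spanning
-- trees, and the trees left after merging c and z. A fan with its root edge, having s forests
-- separating c from z and t trees joining them, sends (A, B) to (s A + t B, s B). From (0, 1), r
-- fans lead to (r t s^(r-1), s^r), whose first component is the formula.

-- Connectivity by edge lists, and simple paths.

module _ {V : Set} where

  edge⇒connected : ∀ {es : List (V × V)} {a b} → (a , b) ∈ es → Connected es a b
  edge⇒connected = EqClosure.return

  connected-sym : ∀ {es : List (V × V)} {x y} → Connected es x y → Connected es y x
  connected-sym = EqClosure.symmetric _

  connected-⊆ : ∀ {es fs : List (V × V)} → (∀ {e} → e ∈ es → e ∈ fs) →
                ∀ {x y} → Connected es x y → Connected fs x y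
  connected-⊆ es⊆fs = EqClosure.map es⊆fs

  Through : V → V → List (V × V) → V → V → Set
  Through a b es x y = (Connected es x a × Connected es b y) ⊎ (Connected es x b × Connected es a y)

  ◅◅-through : ∀ {a b es x y z} → Connected es x y → Through a b es y z → Through a b es x z
  ◅◅-through s (inj₁ (p , q)) = inj₁ (s ◅◅ p , q)
  ◅◅-through s (inj₂ (p , q)) = inj₂ (s ◅◅ p , q)

  connected-∷⁻ : ∀ {a b es x y} → Connected ((a , b) ∷ es) x y →
                 Connected es x y ⊎ Through a b es x y
  connected-∷⁻ ε = inj₁ ε
  connected-∷⁻ (fwd (there m) ◅ c) = Sum.map (fwd m ◅_) (◅◅-through (fwd m ◅ ε)) (connected-∷⁻ c)
  connected-∷⁻ (bwd (there m) ◅ c) = Sum.map (bwd m ◅_) (◅◅-through (bwd m ◅ ε)) (connected-∷⁻ c)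
  connected-∷⁻ (fwd (here refl) ◅ c) with connected-∷⁻ c
  ... | inj₁ p              = inj₂ (inj₁ (ε , p))
  ... | inj₂ (inj₁ (p , q)) = inj₂ (inj₁ (ε , q))
  ... | inj₂ (inj₂ (p , q)) = inj₁ q
  connected-∷⁻ (bwd (here refl) ◅ c) with connected-∷⁻ c
  ... | inj₁ p              = inj₂ (inj₂ (ε , p))
  ... | inj₂ (inj₁ (p , q)) = inj₁ q
  ... | inj₂ (inj₂ (p , q)) = inj₂ (inj₂ (ε , q))

  connected-through : ∀ {a b es x y} → Through a b es x y → Connected ((a , b) ∷ es) x y
  connected-through (inj₁ (p , q)) = connected-⊆ there p ◅◅ fwd (here refl) ◅ connected-⊆ there q
  connected-through (inj₂ (p , q)) = connected-⊆ there p ◅◅ bwd (here refl) ◅ connected-⊆ there q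

  through⇒endpoints : ∀ {a b es x y} → Connected es x y → Through a b es x y → Connected es a b
  through⇒endpoints c (inj₁ (p , q)) = connected-sym p ◅◅ c ◅◅ connected-sym q
  through⇒endpoints c (inj₂ (p , q)) = q ◅◅ connected-sym c ◅◅ p

  -- The sources omit the endpoint, so `target-fresh` supplies the missing part of vertex
  -- distinctness. It is what allows a path to be closed up into an `IsCycle`.
  record SimplePath (es : List (V × V)) (x y : V) : Set where
    constructor simplePath
    field
      darts          : List (Dart es)
      walk           : IsWalk es x darts y
      edges-unique   : Unique (map proj₁ darts)
      sources-unique : Unique (map (source es) darts)
      target-fresh   : All (_≢ y) (map (source es) darts)

module _ {V : Set} (es : List (V × V)) where

  walk-++ : ∀ {u v w} ds {ds′} → IsWalk es u ds v → IsWalk es v ds′ w → IsWalk es u (ds ++ ds′) w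
  walk-++ []       refl    q = q
  walk-++ (_ ∷ ds) (p , r) q = p , walk-++ ds r q

  dart-connects : ∀ d → Connected es (source es d) (target es d)
  dart-connects (i , false) = edge⇒connected (∈-lookup i)
  dart-connects (i , true)  = connected-sym (edge⇒connected (∈-lookup i))

  walk⇒connected : ∀ {u w} ds → IsWalk es u ds w → Connected es u w
  walk⇒connected []       refl       = ε
  walk⇒connected (d ∷ ds) (refl , p) = dart-connects d ◅◅ walk⇒connected ds p

  walk-sources : ∀ {u w} ds → IsWalk es u ds w → All (λ d → Connected es u (source es d)) ds
  walk-sources []       _          = []
  walk-sources (d ∷ ds) (refl , p) = ε ∷ All.map (dart-connects d ◅◅_) (walk-sources ds p)

  same-edge⇒connected : ∀ d d′ → proj₁ d ≡ proj₁ d′ → Connected es (source es d) (source es d′)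
  same-edge⇒connected (i , false) (_ , false) refl = ε
  same-edge⇒connected (i , false) (_ , true)  refl = dart-connects (i , false)
  same-edge⇒connected (i , true)  (_ , false) refl = dart-connects (i , true)
  same-edge⇒connected (i , true)  (_ , true)  refl = ε

-- Acyclicity when one edge is added.

module AddEdge {V : Set} (a b : V) (es : List (V × V)) where

  private
    es⁺ : List (V × V)
    es⁺ = (a , b) ∷ es

  weaken : Dart es → Dart es⁺
  weaken (i , o) = suc i , o

  source-weaken : ∀ d → source es⁺ (weaken d) ≡ source es d
  source-weaken (_ , false) = refl
  source-weaken (_ , true)  = refl

  target-weaken : ∀ d → target es⁺ (weaken d) ≡ target es d
  target-weaken (_ , false) = refl
  target-weaken (_ , true)  = refl

  map-proj₁-weaken : ∀ ds → map proj₁ (map weaken ds) ≡ map suc (map proj₁ ds)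
  map-proj₁-weaken ds = trans (sym (List.map-∘ ds)) (List.map-∘ ds)

  map-source-weaken : ∀ ds → map (source es⁺) (map weaken ds) ≡ map (source es) ds
  map-source-weaken ds = trans (sym (List.map-∘ ds)) (List.map-cong source-weaken ds)

  walk-weaken⁺ : ∀ {u w} ds → IsWalk es u ds w → IsWalk es⁺ u (map weaken ds) w
  walk-weaken⁺ []       p       = p
  walk-weaken⁺ {w = w} (d ∷ ds) (p , q) =
    trans p (sym (source-weaken d)) ,
    subst (λ v → IsWalk es⁺ v (map weaken ds) w) (sym (target-weaken d)) (walk-weaken⁺ ds q)

  walk-weaken⁻ : ∀ {u w} ds → IsWalk es⁺ u (map weaken ds) w → IsWalk es u ds w
  walk-weaken⁻ []       p       = p
  walk-weaken⁻ {w = w} (d ∷ ds) (p , q) =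
    trans p (source-weaken d) ,
    walk-weaken⁻ ds (subst (λ v → IsWalk es⁺ v (map weaken ds) w) (target-weaken d) q)

  simplePath-weaken : ∀ {x y} → SimplePath es x y → SimplePath es⁺ x y
  simplePath-weaken (simplePath ds p u v t) = simplePath (map weaken ds) (walk-weaken⁺ ds p)
    (subst Unique (sym (map-proj₁-weaken ds)) (Unique.map⁺ Fin.suc-injective u))
    (subst Unique (sym (map-source-weaken ds)) v)
    (subst (All _) (sym (map-source-weaken ds)) t)

  -- The two halves are disjoint because they lie in different components of es.
  simplePath-join : ∀ {x y} o → ¬ Connected es x y →
                    SimplePath es x (source es⁺ (zero , o)) → SimplePath es (target es⁺ (zero , o)) y →
                    SimplePath es⁺ x y
  simplePath-join {x} {y} o ¬xy (simplePath ds₁ p₁ u₁ v₁ t₁) (simplePath ds₂ p₂ u₂ v₂ t₂) =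
    simplePath (map weaken ds₁ ++ d ∷ map weaken ds₂)
      (walk-++ es⁺ (map weaken ds₁) (walk-weaken⁺ ds₁ p₁) (refl , walk-weaken⁺ ds₂ p₂))
      (subst Unique (sym edges≡)
        (Unique.++⁺ (Unique.map⁺ Fin.suc-injective u₁)
          (All.map⁺ (All.universal (λ _ ()) _) ∷ Unique.map⁺ Fin.suc-injective u₂)
          edges-disjoint))
      (subst Unique (sym sources≡)
        (Unique.++⁺ v₁ (All.map⁺ (All.map (λ c s≡ → s≁y (subst (λ v → Connected es v y) (sym s≡) c)) to-y) ∷ v₂)
          sources-disjoint))
      (subst (All _) (sym sources≡)
        (All.++⁺ (All.map⁺ (All.map (λ c s≡y → ¬xy (subst (Connected es x) s≡y c)) from-x))
          ((λ s≡y → s≁y (subst (Connected es s) s≡y ε)) ∷ t₂)))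
    where
    d : Dart es⁺
    d = zero , o

    s : V
    s = source es⁺ d

    from-x : All (λ d → Connected es x (source es d)) ds₁
    from-x = walk-sources es ds₁ p₁

    to-y : All (λ d → Connected es (source es d) y) ds₂
    to-y = All.map (λ c → connected-sym c ◅◅ walk⇒connected es ds₂ p₂) (walk-sources es ds₂ p₂)

    s≁y : ¬ Connected es s y
    s≁y c = ¬xy (walk⇒connected es ds₁ p₁ ◅◅ c)

    edges≡ : map proj₁ (map weaken ds₁ ++ d ∷ map weaken ds₂)
             ≡ map suc (map proj₁ ds₁) ++ zero ∷ map suc (map proj₁ ds₂)
    edges≡ = trans (List.map-++ proj₁ (map weaken ds₁) (d ∷ map weaken ds₂))
      (cong₂ (λ p q → p ++ zero ∷ q) (map-proj₁-weaken ds₁) (map-proj₁-weaken ds₂))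

    sources≡ : map (source es⁺) (map weaken ds₁ ++ d ∷ map weaken ds₂)
               ≡ map (source es) ds₁ ++ s ∷ map (source es) ds₂
    sources≡ = trans (List.map-++ (source es⁺) (map weaken ds₁) (d ∷ map weaken ds₂))
      (cong₂ (λ p q → p ++ s ∷ q) (map-source-weaken ds₁) (map-source-weaken ds₂))

    edges-disjoint : ∀ {i} → ¬ (i ∈ map suc (map proj₁ ds₁) × i ∈ zero ∷ map suc (map proj₁ ds₂))
    edges-disjoint (p , here refl) with ∈-map⁻ suc p
    ... | _ , _ , ()
    edges-disjoint (p , there q) with ∈-map⁻ suc p | ∈-map⁻ suc q
    ... | _ , m , refl | _ , m′ , refl with ∈-map⁻ proj₁ m | ∈-map⁻ proj₁ m′
    ... | d₁ , d₁∈ , eq₁ | d₂ , d₂∈ , eq₂ =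
      ¬xy (All.lookup from-x d₁∈
        ◅◅ same-edge⇒connected es d₁ d₂ (trans (sym eq₁) eq₂)
        ◅◅ All.lookup to-y d₂∈)

    sources-disjoint : ∀ {v} → ¬ (v ∈ map (source es) ds₁ × v ∈ s ∷ map (source es) ds₂)
    sources-disjoint (p , here refl) = All.lookup t₁ p refl
    sources-disjoint (p , there q) with ∈-map⁻ (source es) p | ∈-map⁻ (source es) q
    ... | d₁ , d₁∈ , eq₁ | d₂ , d₂∈ , eq₂ =
      ¬xy (subst (Connected es x) (trans (sym eq₁) eq₂) (All.lookup from-x d₁∈) ◅◅ All.lookup to-y d₂∈)

  data WeakenedOrThrough (u : V) (ds : List (Dart es⁺)) (w : V) : Set where
    weakened : ∀ ds′ → ds ≡ map weaken ds′ → WeakenedOrThrough u ds w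
    through  : Through a b es u w → WeakenedOrThrough u ds w

  strengthen : ∀ ds → All (zero ≢_) (map proj₁ ds) → ∃ λ ds′ → ds ≡ map weaken ds′
  strengthen []                 []       = [] , refl
  strengthen ((zero , _) ∷ _)   (n ∷ _)  = contradiction refl n
  strengthen ((suc i , o) ∷ ds) (_ ∷ ns) with strengthen ds ns
  ... | ds′ , refl = (i , o) ∷ ds′ , refl

  -- Distinct edges let the new edge occur at most once. What follows its use is therefore a walk in
  -- `es`, and what precedes it is absorbed by `◅◅-through`.
  weakenedOrThrough : ∀ {u w} ds → IsWalk es⁺ u ds w → Unique (map proj₁ ds) → WeakenedOrThrough u ds w
  weakenedOrThrough [] _ _ = weakened [] refl
  weakenedOrThrough ((zero , o) ∷ ds) (refl , p) (n ∷ _) with strengthen ds n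
  weakenedOrThrough ((zero , false) ∷ _) (refl , p) _ | ds′ , refl =
    through (inj₁ (ε , walk⇒connected es ds′ (walk-weaken⁻ ds′ p)))
  weakenedOrThrough ((zero , true)  ∷ _) (refl , p) _ | ds′ , refl =
    through (inj₂ (ε , walk⇒connected es ds′ (walk-weaken⁻ ds′ p)))
  weakenedOrThrough ((suc i , o) ∷ ds) (refl , p) (_ ∷ u) with weakenedOrThrough ds p u
  ... | weakened ds′ refl = weakened ((i , o) ∷ ds′) refl
  ... | through th =
    through (◅◅-through
      (subst₂ (Connected es) (sym (source-weaken (i , o))) (sym (target-weaken (i , o))) (dart-connects es (i , o))) th)

  -- A cycle using the new edge yields a `Through` from a vertex to itself, and hence a connection
  -- of `a` with `b` inside `es`. Any other cycle already lives in `es`.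
  acyclic-∷⁺ : ¬ Connected es a b → Acyclic es → Acyclic es⁺
  acyclic-∷⁺ ¬ab ac (d ∷ ds) (p , u , v) with weakenedOrThrough (d ∷ ds) p u
  ... | through th = ¬ab (through⇒endpoints ε th)
  ... | weakened (d′ ∷ ds′) refl = ac (d′ ∷ ds′)
    ( subst (λ x → IsWalk es x (d′ ∷ ds′) x) (source-weaken d′) (walk-weaken⁻ (d′ ∷ ds′) p)
    , Unique.map⁻ (subst Unique (map-proj₁-weaken (d′ ∷ ds′)) u)
    , subst Unique (map-source-weaken (d′ ∷ ds′)) v )

  acyclic-tail : Acyclic es⁺ → Acyclic es
  acyclic-tail ac (d ∷ ds) (p , u , v) = ac (map weaken (d ∷ ds))
    ( subst (λ x → IsWalk es⁺ x (map weaken (d ∷ ds)) x) (sym (source-weaken d)) (walk-weaken⁺ (d ∷ ds) p)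
    , subst Unique (sym (map-proj₁-weaken (d ∷ ds))) (Unique.map⁺ Fin.suc-injective u)
    , subst Unique (sym (map-source-weaken (d ∷ ds))) v )

open AddEdge using (acyclic-∷⁺; acyclic-tail)

module _ {V : Set} (_≟_ : DecidableEquality V) where

  -- Induction on the edge list replaces loop erasure. The head edge is used only if `x` and `y` are
  -- not connected without it; the pieces before and after it then lie in different components and
  -- cannot meet.
  connected⇒simplePath : ∀ es {x y} → Connected es x y → SimplePath es x y
  connected⇒simplePath [] ε = simplePath [] refl [] [] []
  connected⇒simplePath [] (fwd () ◅ _)
  connected⇒simplePath [] (bwd () ◅ _)
  connected⇒simplePath ((a , b) ∷ es) {x} {y} c with connected? _≟_ es x y | connected-∷⁻ c
  ... | yes c′ | _       = AddEdge.simplePath-weaken a b es (connected⇒simplePath es c′)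
  ... | no ¬c′ | inj₁ c′ = contradiction c′ ¬c′
  ... | no ¬c′ | inj₂ (inj₁ (p , q)) =
    AddEdge.simplePath-join a b es false ¬c′ (connected⇒simplePath es p) (connected⇒simplePath es q)
  ... | no ¬c′ | inj₂ (inj₂ (p , q)) =
    AddEdge.simplePath-join a b es true ¬c′ (connected⇒simplePath es p) (connected⇒simplePath es q)

  -- A simple path in `es` from `b` back to `a`, preceded by the new edge, is a cycle;
  -- `target-fresh` keeps `a` from being a source twice.
  acyclic-head : ∀ a b es → Acyclic ((a , b) ∷ es) → ¬ Connected es a b
  acyclic-head a b es ac ab with connected⇒simplePath es (connected-sym ab)
  ... | simplePath ds p u v t = ac ((zero , false) ∷ map weaken ds)
    ( (refl , walk-weaken⁺ ds p)
    , subst (λ is → Unique (zero ∷ is)) (sym (map-proj₁-weaken ds))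
        (All.map⁺ (All.universal (λ _ ()) _) ∷ Unique.map⁺ Fin.suc-injective u)
    , subst (λ vs → Unique (a ∷ vs)) (sym (map-source-weaken ds)) (All.map (λ n e → n (sym e)) t ∷ v) )
    where open AddEdge a b es

-- Counting the sublists with a given property.

count : {A : Set} {P : List A → Set} → Decidable P → List A → ℕ
count P? xs = length (filter P? (sublists xs))

length-filter-map : {A B : Set} {P : B → Set} (P? : Decidable P) (f : A → B) (xs : List A) →
                    length (filter P? (map f xs)) ≡ length (filter (P? ∘ f) xs)
length-filter-map P? f [] = refl
length-filter-map P? f (x ∷ xs) with does (P? (f x))
... | true  = cong suc (length-filter-map P? f xs)
... | false = length-filter-map P? f xs

module _ {A : Set} where

  count-∷ : {P : List A → Set} (P? : Decidable P) (x : A) (xs : List A) →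
            count P? (x ∷ xs) ≡ count (P? ∘ (x ∷_)) xs + count P? xs
  count-∷ P? x xs = begin
    length (filter P? (map (x ∷_) (sublists xs) ++ sublists xs))
      ≡⟨ cong length (List.filter-++ P? (map (x ∷_) (sublists xs)) (sublists xs)) ⟩
    length (filter P? (map (x ∷_) (sublists xs)) ++ filter P? (sublists xs))
      ≡⟨ List.length-++ (filter P? (map (x ∷_) (sublists xs))) ⟩
    length (filter P? (map (x ∷_) (sublists xs))) + count P? xs
      ≡⟨ cong (_+ count P? xs) (length-filter-map P? (x ∷_) (sublists xs)) ⟩
    count (P? ∘ (x ∷_)) xs + count P? xs ∎
    where open ≡-Reasoning

  count-cong : {P Q : List A → Set} (P? : Decidable P) (Q? : Decidable Q) →
               (∀ xs → P xs → Q xs) → (∀ xs → Q xs → P xs) → ∀ xs → count P? xs ≡ count Q? xs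
  count-cong P? Q? P⇒Q Q⇒P xs =
    cong length (List.filter-≐ P? Q? ((λ {ys} → P⇒Q ys) , (λ {ys} → Q⇒P ys)) (sublists xs))

  count-none : {P : List A → Set} (P? : Decidable P) → (∀ xs → ¬ P xs) → ∀ xs → count P? xs ≡ 0
  count-none P? ¬P xs = cong length (List.filter-none P? (All.universal ¬P (sublists xs)))

  -- In the `swap` case the sublists split into four classes by which of `x`, `y` they contain. The
  -- two mixed classes trade places, and `resp` handles the class containing both.
  count-↭ : {P : List A → Set} (P? : Decidable P) → (∀ {xs ys} → xs ↭ ys → P xs → P ys) →
            ∀ {xs ys} → xs ↭ ys → count P? xs ≡ count P? ys
  count-↭ P? resp Perm.refl = refl
  count-↭ P? resp (Perm.prep {xs} {ys} x p) = begin
    count P? (x ∷ xs)                            ≡⟨ count-∷ P? x xs ⟩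
    count (P? ∘ (x ∷_)) xs + count P? xs         ≡⟨ cong₂ _+_ (count-↭ (P? ∘ (x ∷_)) (resp ∘ Perm.prep x) p)
                                                              (count-↭ P? resp p) ⟩
    count (P? ∘ (x ∷_)) ys + count P? ys         ≡⟨ count-∷ P? x ys ⟨
    count P? (x ∷ ys)                            ∎
    where open ≡-Reasoning
  count-↭ P? resp (Perm.swap {xs} {ys} x y p) = begin
    count P? (x ∷ y ∷ xs)
      ≡⟨ count-∷₂ x y xs ⟩
    (count (P? ∘ (x ∷_) ∘ (y ∷_)) xs + count (P? ∘ (x ∷_)) xs) + (count (P? ∘ (y ∷_)) xs + count P? xs)
      ≡⟨ cong₂ _+_
           (cong₂ _+_ (trans (count-cong (P? ∘ (x ∷_) ∘ (y ∷_)) (P? ∘ (y ∷_) ∘ (x ∷_))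
                               (λ _ → resp (Perm.swap x y Perm.refl)) (λ _ → resp (Perm.swap y x Perm.refl)) xs)
                             (count-↭ (P? ∘ (y ∷_) ∘ (x ∷_)) (resp ∘ Perm.prep y ∘ Perm.prep x) p))
                      (count-↭ (P? ∘ (x ∷_)) (resp ∘ Perm.prep x) p))
           (cong₂ _+_ (count-↭ (P? ∘ (y ∷_)) (resp ∘ Perm.prep y) p) (count-↭ P? resp p)) ⟩
    (count (P? ∘ (y ∷_) ∘ (x ∷_)) ys + count (P? ∘ (x ∷_)) ys) + (count (P? ∘ (y ∷_)) ys + count P? ys)
      ≡⟨ interchange (count (P? ∘ (y ∷_) ∘ (x ∷_)) ys) _ _ _ ⟩
    (count (P? ∘ (y ∷_) ∘ (x ∷_)) ys + count (P? ∘ (y ∷_)) ys) + (count (P? ∘ (x ∷_)) ys + count P? ys)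
      ≡⟨ count-∷₂ y x ys ⟨
    count P? (y ∷ x ∷ ys) ∎
    where
    open ≡-Reasoning
    count-∷₂ : ∀ x y xs → count P? (x ∷ y ∷ xs) ≡
      (count (P? ∘ (x ∷_) ∘ (y ∷_)) xs + count (P? ∘ (x ∷_)) xs) + (count (P? ∘ (y ∷_)) xs + count P? xs)
    count-∷₂ x y xs = trans (count-∷ P? x (y ∷ xs))
      (cong₂ _+_ (count-∷ (P? ∘ (x ∷_)) y xs) (count-∷ P? y xs))
  count-↭ P? resp (Perm.trans p q) = trans (count-↭ P? resp p) (count-↭ P? resp q)

-- A sublist that uses a removed entry violates `Q` there, so it was never counted. This is how
-- loops will be discarded.
count-filter : {A : Set} {P : List A → Set} {Q : A → Set} (P? : Decidable P) (Q? : Decidable Q) →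
               (∀ xs → P xs → All Q xs) → ∀ xs → count P? (filter Q? xs) ≡ count P? xs
count-filter P? Q? P⇒Q [] = refl
count-filter P? Q? P⇒Q (x ∷ xs) with Q? x
... | yes _  = trans (count-∷ P? x (filter Q? xs)) (trans
  (cong₂ _+_ (count-filter (P? ∘ (x ∷_)) Q? (λ ys → All.tail ∘ P⇒Q (x ∷ ys)) xs) (count-filter P? Q? P⇒Q xs))
  (sym (count-∷ P? x xs)))
... | no ¬Qx = trans (count-filter P? Q? P⇒Q xs) (sym (trans (count-∷ P? x xs)
  (cong (_+ count P? xs) (count-none (P? ∘ (x ∷_)) (λ ys → ¬Qx ∘ All.head ∘ P⇒Q (x ∷ ys)) xs))))

count-map : {A B : Set} {P : List B → Set} (P? : Decidable P) (f : A → B) (xs : List A) →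
            count P? (map f xs) ≡ count (P? ∘ map f) xs
count-map P? f []       = length-filter-map P? (map f) ([] ∷ [])
count-map P? f (x ∷ xs) = begin
  count P? (f x ∷ map f xs)
    ≡⟨ count-∷ P? (f x) (map f xs) ⟩
  count (P? ∘ (f x ∷_)) (map f xs) + count P? (map f xs)
    ≡⟨ cong₂ _+_ (count-map (P? ∘ (f x ∷_)) f xs) (count-map P? f xs) ⟩
  count (P? ∘ (f x ∷_) ∘ map f) xs + count (P? ∘ map f) xs
    ≡⟨ count-∷ (P? ∘ map f) x xs ⟨
  count (P? ∘ map f) (x ∷ xs) ∎
  where open ≡-Reasoning

-- Spanning-tree counts and deletion-contraction.

mapEdges : {V W : Set} → (V → W) → List (V × V) → List (W × W)
mapEdges f = map (Product.map f f)

connected-[] : {V : Set} {x y : V} → Connected [] x y → x ≡ y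
connected-[] ε = refl
connected-[] (fwd () ◅ _)
connected-[] (bwd () ◅ _)

acyclic-[] : {V : Set} → Acyclic {V} []
acyclic-[] ((() , _) ∷ _)

connected-↭ : {V : Set} {es fs : List (V × V)} → es ↭ fs → ∀ {x y} → Connected es x y → Connected fs x y
connected-↭ p = connected-⊆ (Perm.∈-resp-↭ p)

module _ {V : Set} (_≟_ : DecidableEquality V) where

  -- The `swap` case is an exchange argument: if the edge `a b` is what joins `c` to `d`, then the
  -- edge `c d` already joins `a` to `b`, so the original order had a cycle.
  acyclic-↭ : ∀ {es fs} → es ↭ fs → Acyclic {V} es → Acyclic fs
  acyclic-↭ Perm.refl ac = ac
  acyclic-↭ (Perm.prep (a , b) p) ac =
    acyclic-∷⁺ a b _ (acyclic-head _≟_ a b _ ac ∘ connected-↭ (↭-sym p)) (acyclic-↭ p (acyclic-tail a b _ ac))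
  acyclic-↭ (Perm.swap {es} {fs} (a , b) (c , d) p) ac =
    acyclic-∷⁺ c d _ (¬cd ∘ connected-↭ (↭-sym (Perm.prep _ p)))
      (acyclic-∷⁺ a b _ (acyclic-head _≟_ a b _ ac ∘ connected-⊆ there ∘ connected-↭ (↭-sym p))
        (acyclic-↭ p (acyclic-tail c d _ ac′)))
    where
    ac′ : Acyclic ((c , d) ∷ es)
    ac′ = acyclic-tail a b _ ac

    ¬cd : ¬ Connected ((a , b) ∷ es) c d
    ¬cd cd with connected-∷⁻ cd
    ... | inj₁ cd′            = acyclic-head _≟_ c d es ac′ cd′
    ... | inj₂ (inj₁ (p , q)) = acyclic-head _≟_ a b _ ac (connected-through (inj₁ (connected-sym p , connected-sym q)))
    ... | inj₂ (inj₂ (p , q)) = acyclic-head _≟_ a b _ ac (connected-through (inj₂ (q , p)))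
  acyclic-↭ (Perm.trans p q) ac = acyclic-↭ q (acyclic-↭ p ac)

  -- `IsSpanningTree` without the bundled graph: contraction may repeat vertices in the list, and no
  -- membership proof for endpoints has to be carried. For a `Multigraph` the two unfold to the same
  -- thing, so `τ` is a `treeCount` by definition.
  Spanning : List V → List (V × V) → Set
  Spanning ws es = Acyclic es × All (λ u → All (λ v → Connected es u v) ws) ws

  spanning? : ∀ ws → Decidable (Spanning ws)
  spanning? ws es = acyclic? _≟_ es ×-dec All.all? (λ u → All.all? (connected? _≟_ es u) ws) ws

  treeCount : List V → List (V × V) → ℕ
  treeCount ws = count (spanning? ws)

  private
    all-pairs⁺ : ∀ {ws} {R : V → V → Set} → (∀ {u v} → u ∈ ws → v ∈ ws → R u v) → All (λ u → All (R u) ws) ws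
    all-pairs⁺ r = All.tabulate (λ u∈ → All.tabulate (r u∈))

    all-pairs⁻ : ∀ {ws} {R : V → V → Set} → All (λ u → All (R u) ws) ws → ∀ {u v} → u ∈ ws → v ∈ ws → R u v
    all-pairs⁻ all u∈ v∈ = All.lookup (All.lookup all u∈) v∈

  treeCount-↭ : ∀ ws {E F} → E ↭ F → treeCount ws E ≡ treeCount ws F
  treeCount-↭ ws = count-↭ (spanning? ws)
    (λ p (ac , conn) → acyclic-↭ p ac , All.map (All.map (connected-↭ p)) conn)

  treeCount-vertices : ∀ {ws ws′} → (∀ {v} → v ∈ ws → v ∈ ws′) → (∀ {v} → v ∈ ws′ → v ∈ ws) →
                       ∀ E → treeCount ws E ≡ treeCount ws′ E
  treeCount-vertices {ws} {ws′} ws⊆ws′ ws′⊆ws = count-cong (spanning? ws) (spanning? ws′)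
    (λ _ (ac , conn) → ac , all-pairs⁺ (λ u∈ v∈ → all-pairs⁻ conn (ws′⊆ws u∈) (ws′⊆ws v∈)))
    (λ _ (ac , conn) → ac , all-pairs⁺ (λ u∈ v∈ → all-pairs⁻ conn (ws⊆ws′ u∈) (ws⊆ws′ v∈)))

  treeCount-loop : ∀ ws a E → treeCount ws ((a , a) ∷ E) ≡ treeCount ws E
  treeCount-loop ws a E = trans (count-∷ (spanning? ws) (a , a) E)
    (cong (_+ treeCount ws E)
      (count-none (spanning? ws ∘ ((a , a) ∷_)) (λ es (ac , _) → acyclic-head _≟_ a a es ac ε) E))

  acyclic⇒no-loops : ∀ es → Acyclic es → All (λ e → proj₁ e ≢ proj₂ e) es
  acyclic⇒no-loops []             _  = []
  acyclic⇒no-loops ((a , b) ∷ es) ac =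
    (λ { refl → acyclic-head _≟_ a b es ac ε }) ∷ acyclic⇒no-loops es (acyclic-tail a b es ac)

  treeCount-filter-loops : ∀ ws (loopless? : Decidable (λ (e : V × V) → proj₁ e ≢ proj₂ e)) E →
                           treeCount ws (filter loopless? E) ≡ treeCount ws E
  treeCount-filter-loops ws loopless? =
    count-filter (spanning? ws) loopless? (λ es (ac , _) → acyclic⇒no-loops es ac)

  -- `f-within` forces `f` to fix every vertex other than `a` and `b` and to keep these two among
  -- themselves. With `fa≡fb`, such an `f` is contraction of the edge `a b`, onto either end.
  module _ {a b : V} {f : V → V} (fa≡fb : f a ≡ f b) (f-within : ∀ x → Connected ((a , b) ∷ []) x (f x)) where

    connected-contract⁺ : ∀ {es x y} → Connected ((a , b) ∷ es) x y → Connected (mapEdges f es) (f x) (f y)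
    connected-contract⁺ {es} = EqClosure.gfold (EqClosure.isEquivalence _) f
      (λ { (here refl) → subst (Connected _ (f a)) fa≡fb ε ; (there m) → edge⇒connected (∈-map⁺ _ m) })

    -- Every vertex is joined to its image by the contracted edge, so each step between images
    -- lifts.
    connected-contract⁻ : ∀ {es x y} → Connected (mapEdges f es) (f x) (f y) → Connected ((a , b) ∷ es) x y
    connected-contract⁻ {es} {x} {y} c = to x ◅◅ EqClosure.fold (EqClosure.isEquivalence _) edge c ◅◅ connected-sym (to y)
      where
      to : ∀ x → Connected ((a , b) ∷ es) x (f x)
      to x = connected-⊆ (λ { (here eq) → here eq }) (f-within x)

      edge : ∀ {u v} → (u , v) ∈ mapEdges f es → Connected ((a , b) ∷ es) u v
      edge m with ∈-map⁻ _ m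
      ... | (x , y) , m′ , refl = connected-sym (to x) ◅◅ fwd (there m′) ◅ to y

    acyclic-contract⁺ : ∀ es → Acyclic ((a , b) ∷ es) → Acyclic (mapEdges f es)
    acyclic-contract⁺ []             _  = acyclic-[]
    acyclic-contract⁺ ((x , y) ∷ es) ac =
      acyclic-∷⁺ (f x) (f y) _ (acyclic-head _≟_ x y _ ac′ ∘ connected-contract⁻)
        (acyclic-contract⁺ es (acyclic-tail x y _ ac′))
      where
      ac′ : Acyclic ((x , y) ∷ (a , b) ∷ es)
      ac′ = acyclic-↭ (Perm.swap _ _ Perm.refl) ac

    -- The induction runs over the other edges, hence the swaps past the contracted edge. At the end
    -- that edge stands alone, and `a ≢ b` says it is no loop.
    acyclic-contract⁻ : a ≢ b → ∀ es → Acyclic (mapEdges f es) → Acyclic ((a , b) ∷ es)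
    acyclic-contract⁻ a≢b []             _  = acyclic-∷⁺ a b [] (a≢b ∘ connected-[]) acyclic-[]
    acyclic-contract⁻ a≢b ((x , y) ∷ es) ac = acyclic-↭ (Perm.swap _ _ Perm.refl)
      (acyclic-∷⁺ x y _ (acyclic-head _≟_ (f x) (f y) _ ac ∘ connected-contract⁺)
        (acyclic-contract⁻ a≢b es (acyclic-tail (f x) (f y) _ ac)))

    -- Deletion-contraction: sublists containing the edge are trees exactly when their remainder is
    -- a tree after contraction. The match is by position, so parallel edges and loops created by
    -- `f` need no care.
    treeCount-contract : a ≢ b → ∀ ws E →
      treeCount ws ((a , b) ∷ E) ≡ treeCount (map f ws) (mapEdges f E) + treeCount ws E
    treeCount-contract a≢b ws E = trans (count-∷ (spanning? ws) (a , b) E) (cong (_+ treeCount ws E)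
      (trans
        (count-cong (spanning? ws ∘ ((a , b) ∷_)) (spanning? (map f ws) ∘ mapEdges f)
          (λ es (ac , conn) → acyclic-contract⁺ es ac ,
            All.map⁺ (All.map (All.map⁺ ∘ All.map connected-contract⁺) conn))
          (λ es (ac , conn) → acyclic-contract⁻ a≢b es ac ,
            All.map (All.map connected-contract⁻ ∘ All.map⁻) (All.map⁻ conn))
          E)
        (sym (count-map (spanning? (map f ws)) (Product.map f f) E))))

module _ {A : Set} where

  sublists-All : {Q : A → Set} {xs : List A} → All Q xs → All (All Q) (sublists xs)
  sublists-All []       = [] ∷ []
  sublists-All (q ∷ qs) =
    All.++⁺ (All.map⁺ (All.map (q ∷_) (sublists-All qs))) (sublists-All qs)

-- Fibonacci and Lucas identities.

-- Here `k` is the number of path vertices of a fan, so q = k + 1 and `evenFib k` is F_2q.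
-- `bridgeCount k` is L_2q - 2 - F_2q, the trees joining hub and terminal without the root edge; it
-- is defined by the recurrence that the fan obeys, which avoids truncated subtraction.
evenFib oddFib bridgeCount : ℕ → ℕ
evenFib k = fib (2 + 2 * k)
oddFib  k = fib (1 + 2 * k)
bridgeCount zero    = 0
bridgeCount (suc k) = bridgeCount k + (evenFib k + evenFib k)

oddFib-suc : ∀ k → oddFib (suc k) ≡ evenFib k + oddFib k
oddFib-suc k = cong (fib ∘ suc) (*-suc 2 k)

evenFib-suc : ∀ k → evenFib (suc k) ≡ oddFib (suc k) + evenFib k
evenFib-suc k = cong (oddFib (suc k) +_) (cong fib (*-suc 2 k))

lucas-fib : ∀ n → lucas (suc n) ≡ fib (suc (suc n)) + fib n
lucas-fib zero          = refl
lucas-fib (suc zero)    = refl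
lucas-fib (suc (suc n)) = trans (cong₂ _+_ (lucas-fib (suc n)) (lucas-fib n))
  (interchange (fib (3 + n)) (fib (suc n)) (fib (2 + n)) (fib n))

lucas-bridgeCount : ∀ k → lucas (2 * suc k) ≡ 2 + (evenFib k + bridgeCount k)
lucas-bridgeCount zero    = refl
lucas-bridgeCount (suc k) = begin
  lucas (2 * suc (suc k))
    ≡⟨ cong lucas (*-suc 2 (suc k)) ⟩
  lucas (suc (2 * suc k)) + lucas (2 * suc k)
    ≡⟨ cong₂ _+_ (lucas-fib (2 * suc k)) (lucas-bridgeCount k) ⟩
  evenFib (suc k) + fib (2 * suc k) + (2 + (evenFib k + bridgeCount k))
    ≡⟨ cong (λ n → evenFib (suc k) + fib n + (2 + (evenFib k + bridgeCount k))) (*-suc 2 k) ⟩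
  evenFib (suc k) + evenFib k + (2 + (evenFib k + bridgeCount k))
    ≡⟨ rearrange (evenFib (suc k)) (evenFib k) (bridgeCount k) ⟩
  2 + (evenFib (suc k) + bridgeCount (suc k)) ∎
  where
  open ≡-Reasoning
  rearrange : ∀ s e b → s + e + (2 + (e + b)) ≡ 2 + (s + (b + (e + e)))
  rearrange = solve-∀

-- The path u, vs, z together with a spoke to the hub c from each member of vs only.
fan : {V : Set} → V → V → List V → V → List (V × V)
fan c u []       z = (u , z) ∷ []
fan c u (v ∷ vs) z = (u , v) ∷ (c , v) ∷ fan c v vs z

-- Deletion-contraction along a fan.

module _ {V : Set} (_≟_ : DecidableEquality V) where

  treeCount-isolated : ∀ {ws v w} → v ∈ ws → w ∈ ws → w ≢ v →
                       ∀ {E} → All (λ e → proj₁ e ≢ v × proj₂ e ≢ v) E → treeCount _≟_ ws E ≡ 0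
  treeCount-isolated {ws} {v} {w} v∈ w∈ w≢v avoids = cong length (List.filter-none (spanning? _≟_ ws)
    (All.map (λ av (_ , conn) → w≢v (stuck av (All.lookup (All.lookup conn v∈) w∈))) (sublists-All avoids)))
    where
    stuck : ∀ {es x} → All (λ e → proj₁ e ≢ v × proj₂ e ≢ v) es → Connected es v x → x ≡ v
    stuck av ε           = refl
    stuck av (fwd m ◅ _) = contradiction refl (proj₁ (All.lookup av m))
    stuck av (bwd m ◅ _) = contradiction refl (proj₂ (All.lookup av m))

  redirect : V → V → V → V
  redirect v x y with y ≟ v
  ... | yes _ = x
  ... | no  _ = y

  redirect-hit : ∀ v x → redirect v x v ≡ x
  redirect-hit v x with v ≟ v
  ... | yes _  = refl
  ... | no v≢v = contradiction refl v≢v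

  redirect-miss : ∀ {v x y} → y ≢ v → redirect v x y ≡ y
  redirect-miss {v} {x} {y} y≢v with y ≟ v
  ... | yes y≡v = contradiction y≡v y≢v
  ... | no  _   = refl

  redirect-within : ∀ {v x es} → Connected es v x → ∀ y → Connected es y (redirect v x y)
  redirect-within {v} c y with y ≟ v
  ... | yes refl = c
  ... | no  _    = ε

  redirect-equal : ∀ {v x} → redirect v x x ≡ redirect v x v
  redirect-equal {v} {x} with x ≟ v
  ... | yes refl = sym (redirect-hit v v)
  ... | no  _    = sym (redirect-hit v x)

  treeCount-absorb : ∀ {v x} → x ≢ v → ∀ ws E → treeCount _≟_ ws ((x , v) ∷ E) ≡
    treeCount _≟_ (map (redirect v x) ws) (mapEdges (redirect v x) E) + treeCount _≟_ ws E
  treeCount-absorb x≢v = treeCount-contract _≟_ redirect-equal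
    (redirect-within (bwd (here refl) ◅ ε)) x≢v

  treeCount-absorb′ : ∀ {v x} → x ≢ v → ∀ ws E → treeCount _≟_ ws ((v , x) ∷ E) ≡
    treeCount _≟_ (map (redirect v x) ws) (mapEdges (redirect v x) E) + treeCount _≟_ ws E
  treeCount-absorb′ x≢v = treeCount-contract _≟_ (sym redirect-equal)
    (redirect-within (fwd (here refl) ◅ ε)) (x≢v ∘ sym)

  -- A is the number of trees of X, and B the number after merging c and z.
  -- Measuring B by the growth rate in the number m of parallel edges c z keeps
  -- every contraction below at a fresh vertex, which leaves ws and X unchanged.
  module Fan (c z : V) (ws : List V) (c∈ws : c ∈ ws) (z∈ws : z ∈ ws) (X : List (V × V))
             (X⊆ws : All (λ e → proj₁ e ∈ ws × proj₂ e ∈ ws) X)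
             (A B : ℕ) (tc-X : ∀ m → treeCount _≟_ ws (replicate m (c , z) ++ X) ≡ A + m * B) where

    private
      tc : List V → List (V × V) → ℕ
      tc = treeCount _≟_

      Y : ℕ → List (V × V)
      Y m = replicate m (c , z) ++ X

    Y-All : {T : V → Set} → All T ws → ∀ m → All (λ e → T (proj₁ e) × T (proj₂ e)) (Y m)
    Y-All t zero    = All.map (Product.map (All.lookup t) (All.lookup t)) X⊆ws
    Y-All t (suc m) = (All.lookup t c∈ws , All.lookup t z∈ws) ∷ Y-All t m

    fan-All : {T : V → Set} → All T ws → ∀ m {u} → T u → ∀ {vs} → All T vs →
              All (λ e → T (proj₁ e) × T (proj₂ e)) (fan c u vs z ++ Y m)
    fan-All t m tu []        = (tu , All.lookup t z∈ws) ∷ Y-All t m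
    fan-All t m tu (tv ∷ ts) = (tu , tv) ∷ (All.lookup t c∈ws , tv) ∷ fan-All t m tv ts

    mapEdges-Y : ∀ {f} → All (λ y → f y ≡ y) ws → ∀ m → mapEdges f (Y m) ≡ Y m
    mapEdges-Y fix m = List.map-id-local (All.map (λ (p , q) → cong₂ _,_ p q) (Y-All fix m))

    mapEdges-fan : ∀ {f} → All (λ y → f y ≡ y) ws → ∀ m u {vs} → All (λ y → f y ≡ y) vs →
                   mapEdges f (fan c u vs z ++ Y m) ≡ fan c (f u) vs z ++ Y m
    mapEdges-fan fix m u [] = cong₂ _∷_ (cong (_ ,_) (All.lookup fix z∈ws)) (mapEdges-Y fix m)
    mapEdges-fan {f} fix m u {v ∷ vs} (fv ∷ fvs) = cong₂ _∷_ (cong (f u ,_) fv)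
      (cong₂ _∷_ (cong₂ _,_ (All.lookup fix c∈ws) fv)
        (trans (mapEdges-fan fix m v fvs) (cong (λ x → fan c x vs z ++ Y m) fv)))

    drop-vertex : ∀ {x us} → x ∈ us → ∀ E → tc (x ∷ us) E ≡ tc us E
    drop-vertex x∈us = treeCount-vertices _≟_ (λ { (here refl) → x∈us ; (there m) → m }) there

    Fresh : List V → Set
    Fresh vs = Unique vs × All (_∉ ws) vs

    ∉⇒All≢ : ∀ {v} {us : List V} → v ∉ us → All (_≢ v) us
    ∉⇒All≢ v∉us = All.tabulate (λ { m refl → v∉us m })

    fresh-fixes : ∀ {v vs} → Fresh (v ∷ vs) → ∀ x →
                  All (λ y → redirect v x y ≡ y) vs × All (λ y → redirect v x y ≡ y) ws
    fresh-fixes (v∉vs ∷ _ , v∉ws ∷ _) x =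
      All.map (λ n → redirect-miss (λ eq → n (sym eq))) v∉vs , All.map redirect-miss (∉⇒All≢ v∉ws)

    attach : ∀ {v vs x} → Fresh (v ∷ vs) → x ∈ ws → ∀ {E E′} → mapEdges (redirect v x) E ≡ E′ →
             tc (v ∷ vs ++ ws) ((x , v) ∷ E) ≡ tc (vs ++ ws) E′ + tc (v ∷ vs ++ ws) E
    attach {v} {vs} {x} fresh@(_ , v∉ws ∷ _) x∈ws {E} {E′} refl =
      trans (treeCount-absorb (λ { refl → v∉ws x∈ws }) (v ∷ vs ++ ws) E)
        (cong (_+ tc (v ∷ vs ++ ws) E)
          (trans (cong (λ us → tc us E′) (cong₂ _∷_ (redirect-hit v x) (List.map-id-local fixed)))
            (drop-vertex (∈-++⁺ʳ vs x∈ws) E′)))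
      where
      fixed : All (λ y → redirect v x y ≡ y) (vs ++ ws)
      fixed = Product.uncurry All.++⁺ (fresh-fixes fresh x)

    attach-fan : ∀ {v vs x} → Fresh (v ∷ vs) → x ∈ ws → ∀ m →
      tc (v ∷ vs ++ ws) ((x , v) ∷ fan c v vs z ++ Y m) ≡
      tc (vs ++ ws) (fan c x vs z ++ Y m) + tc (v ∷ vs ++ ws) (fan c v vs z ++ Y m)
    attach-fan {v} {vs} {x} fresh x∈ws m = attach fresh x∈ws
      (trans (mapEdges-fan (proj₂ fixes) m v (proj₁ fixes))
        (cong (λ u → fan c u vs z ++ Y m) (redirect-hit v x)))
      where fixes = fresh-fixes fresh x

    attach-spoked-fan : ∀ {v vs x} → Fresh (v ∷ vs) → x ∈ ws → ∀ m →
      tc (v ∷ vs ++ ws) ((x , v) ∷ (c , v) ∷ fan c v vs z ++ Y m) ≡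
      tc (vs ++ ws) ((c , x) ∷ fan c x vs z ++ Y m) + tc (v ∷ vs ++ ws) ((c , v) ∷ fan c v vs z ++ Y m)
    attach-spoked-fan {v} {vs} {x} fresh x∈ws m = attach fresh x∈ws
      (cong₂ _∷_ (cong₂ _,_ (All.lookup (proj₂ fixes) c∈ws) (redirect-hit v x))
        (trans (mapEdges-fan (proj₂ fixes) m v (proj₁ fixes))
          (cong (λ u → fan c u vs z ++ Y m) (redirect-hit v x))))
      where fixes = fresh-fixes fresh x

    -- Once its spoke is deleted, v is a leaf, so its remaining edge is forced.
    pendant-last : ∀ {v} → Fresh (v ∷ []) → ∀ m → tc (v ∷ ws) ((v , z) ∷ Y m) ≡ A + m * B
    pendant-last {v} (_ , v∉ws ∷ _) m = begin
      tc (v ∷ ws) ((v , z) ∷ Y m)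
        ≡⟨ treeCount-absorb′ (λ { refl → v∉ws z∈ws }) (v ∷ ws) (Y m) ⟩
      tc (redirect v z v ∷ map (redirect v z) ws) (mapEdges (redirect v z) (Y m)) + tc (v ∷ ws) (Y m)
        ≡⟨ cong₂ _+_
             (cong₂ tc (cong₂ _∷_ (redirect-hit v z) (List.map-id-local fixed)) (mapEdges-Y fixed m))
             (treeCount-isolated (here refl) (there c∈ws) (λ { refl → v∉ws c∈ws }) (Y-All (∉⇒All≢ v∉ws) m)) ⟩
      tc (z ∷ ws) (Y m) + 0
        ≡⟨ +-identityʳ _ ⟩
      tc (z ∷ ws) (Y m)
        ≡⟨ drop-vertex z∈ws (Y m) ⟩
      tc ws (Y m)
        ≡⟨ tc-X m ⟩
      A + m * B ∎
      where
      open ≡-Reasoning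
      fixed : All (λ y → redirect v z y ≡ y) ws
      fixed = All.map redirect-miss (∉⇒All≢ v∉ws)

    -- Contracting the leaf edge gives `v′` the name `v`, which leaves a spoked fan at `v` with one
    -- vertex fewer. Deleting it isolates `v` and contributes 0.
    pendant-step : ∀ {v v′ vs} → Fresh (v ∷ v′ ∷ vs) → ∀ m →
      tc (v ∷ v′ ∷ vs ++ ws) ((v , v′) ∷ (c , v′) ∷ fan c v′ vs z ++ Y m) ≡
      tc (v ∷ vs ++ ws) ((c , v) ∷ fan c v vs z ++ Y m)
    pendant-step {v} {v′} {vs} ((v≢v′ ∷ v∉vs) ∷ v′∉vs ∷ u , v∉ws ∷ v′∉ws ∷ fr) m = begin
      tc us ((v , v′) ∷ E)
        ≡⟨ treeCount-absorb v≢v′ us E ⟩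
      tc (map f us) (mapEdges f E) + tc us E
        ≡⟨ cong₂ _+_
             (cong₂ tc
               (cong₂ _∷_ (redirect-miss v≢v′) (cong₂ _∷_ (redirect-hit v′ v)
                 (List.map-id-local (All.++⁺ (proj₁ fixes) (proj₂ fixes)))))
               (cong₂ _∷_ (cong₂ _,_ (All.lookup (proj₂ fixes) c∈ws) (redirect-hit v′ v))
                 (trans (mapEdges-fan (proj₂ fixes) m v′ (proj₁ fixes))
                   (cong (λ x → fan c x vs z ++ Y m) (redirect-hit v′ v)))))
             (treeCount-isolated (here refl) (there (there (∈-++⁺ʳ vs c∈ws))) (All.lookup avoid c∈ws)
               ((All.lookup avoid c∈ws , v≢v′ ∘ sym) ∷
                fan-All avoid m (v≢v′ ∘ sym) (All.map (λ n eq → n (sym eq)) v∉vs))) ⟩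
      tc (v ∷ v ∷ vs ++ ws) ((c , v) ∷ fan c v vs z ++ Y m) + 0
        ≡⟨ +-identityʳ _ ⟩
      tc (v ∷ v ∷ vs ++ ws) ((c , v) ∷ fan c v vs z ++ Y m)
        ≡⟨ drop-vertex (here refl) ((c , v) ∷ fan c v vs z ++ Y m) ⟩
      tc (v ∷ vs ++ ws) ((c , v) ∷ fan c v vs z ++ Y m) ∎
      where
      open ≡-Reasoning
      f = redirect v′ v
      us = v ∷ v′ ∷ vs ++ ws
      E = (c , v′) ∷ fan c v′ vs z ++ Y m
      avoid = ∉⇒All≢ v∉ws
      fixes = fresh-fixes (v′∉vs ∷ u , v′∉ws ∷ fr) v

    tail-fresh : ∀ {v vs} → Fresh (v ∷ vs) → Fresh vs
    tail-fresh (_ ∷ u , _ ∷ fr) = u , fr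

    skip-fresh : ∀ {v v′ vs} → Fresh (v ∷ v′ ∷ vs) → Fresh (v ∷ vs)
    skip-fresh ((_ ∷ v∉vs) ∷ _ ∷ u , v∉ws ∷ _ ∷ fr) = v∉vs ∷ u , v∉ws ∷ fr

    -- Proved jointly with `fan-spoked`. At the hub the first path edge and the spoke of `v` are
    -- parallel: contracting one makes the other a loop, deleting one leaves a spoked fan. In a
    -- spoked fan, contracting the spoke moves the start to the hub, and deleting it makes `v` a
    -- leaf. The coefficients of both recurrences combine by the Fibonacci rule at even and odd
    -- indices.
    fan-at-hub : ∀ vs → Fresh vs → ∀ m → tc (vs ++ ws) (fan c c vs z ++ Y m) ≡
                 evenFib (length vs) * (A + m * B) + oddFib (length vs) * B
    fan-spoked : ∀ v vs → Fresh (v ∷ vs) → ∀ m → tc (v ∷ vs ++ ws) ((c , v) ∷ fan c v vs z ++ Y m) ≡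
                 oddFib (suc (length vs)) * (A + m * B) + evenFib (length vs) * B

    fan-at-hub [] _ m = trans (tc-X (suc m)) (rearrange A B m)
      where
      rearrange : ∀ A B m → A + (B + m * B) ≡ 1 * (A + m * B) + 1 * B
      rearrange = solve-∀
    fan-at-hub (v ∷ vs) fresh m = begin
      tc (v ∷ vs ++ ws) ((c , v) ∷ (c , v) ∷ fan c v vs z ++ Y m)
        ≡⟨ attach-spoked-fan fresh c∈ws m ⟩
      tc (vs ++ ws) ((c , c) ∷ fan c c vs z ++ Y m) + tc (v ∷ vs ++ ws) ((c , v) ∷ fan c v vs z ++ Y m)
        ≡⟨ cong₂ _+_ (trans (treeCount-loop _≟_ (vs ++ ws) c (fan c c vs z ++ Y m)) (fan-at-hub vs (tail-fresh fresh) m))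
                     (fan-spoked v vs fresh m) ⟩
      (evenFib k * A′ + oddFib k * B) + (oddFib (suc k) * A′ + evenFib k * B)
        ≡⟨ rearrange (evenFib k) (oddFib k) (oddFib (suc k)) A′ B ⟩
      (oddFib (suc k) + evenFib k) * A′ + (evenFib k + oddFib k) * B
        ≡⟨ cong₂ (λ e o → e * A′ + o * B) (evenFib-suc k) (oddFib-suc k) ⟨
      evenFib (suc k) * A′ + oddFib (suc k) * B ∎
      where
      open ≡-Reasoning
      k = length vs
      A′ = A + m * B
      rearrange : ∀ e o o′ a b → (e * a + o * b) + (o′ * a + e * b) ≡ (o′ + e) * a + (e + o) * b
      rearrange = solve-∀

    fan-spoked v [] fresh m = begin
      tc (v ∷ ws) ((c , v) ∷ fan c v [] z ++ Y m)
        ≡⟨ attach-fan fresh c∈ws m ⟩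
      tc ws (fan c c [] z ++ Y m) + tc (v ∷ ws) ((v , z) ∷ Y m)
        ≡⟨ cong₂ _+_ (fan-at-hub [] ([] , []) m) (pendant-last fresh m) ⟩
      1 * (A + m * B) + 1 * B + (A + m * B)
        ≡⟨ rearrange (A + m * B) B ⟩
      2 * (A + m * B) + 1 * B ∎
      where
      open ≡-Reasoning
      rearrange : ∀ a b → 1 * a + 1 * b + a ≡ 2 * a + 1 * b
      rearrange = solve-∀
    fan-spoked v (v′ ∷ vs) fresh m = begin
      tc (v ∷ v′ ∷ vs ++ ws) ((c , v) ∷ fan c v (v′ ∷ vs) z ++ Y m)
        ≡⟨ attach-fan fresh c∈ws m ⟩
      tc (v′ ∷ vs ++ ws) (fan c c (v′ ∷ vs) z ++ Y m) + tc (v ∷ v′ ∷ vs ++ ws) (fan c v (v′ ∷ vs) z ++ Y m)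
        ≡⟨ cong₂ _+_ (fan-at-hub (v′ ∷ vs) (tail-fresh fresh) m)
                     (trans (pendant-step fresh m) (fan-spoked v vs (skip-fresh fresh) m)) ⟩
      (evenFib (suc k) * A′ + oddFib (suc k) * B) + (oddFib (suc k) * A′ + evenFib k * B)
        ≡⟨ rearrange (evenFib (suc k)) (oddFib (suc k)) (evenFib k) A′ B ⟩
      (evenFib (suc k) + oddFib (suc k)) * A′ + (oddFib (suc k) + evenFib k) * B
        ≡⟨ cong₂ (λ o e → o * A′ + e * B) (oddFib-suc (suc k)) (evenFib-suc k) ⟨
      oddFib (suc (suc k)) * A′ + evenFib (suc k) * B ∎
      where
      open ≡-Reasoning
      k = length vs
      A′ = A + m * B
      rearrange : ∀ e′ o′ e a b → (e′ * a + o′ * b) + (o′ * a + e * b) ≡ (e′ + o′) * a + (o′ + e) * b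
      rearrange = solve-∀

    fan-at-terminal : ∀ vs → Fresh vs → ∀ m → tc (vs ++ ws) (fan c z vs z ++ Y m) ≡
                      evenFib (length vs) * (A + m * B) + bridgeCount (length vs) * B
    -- With no path vertices, the case q = 1, the fan is a single loop at `z`.
    fan-at-terminal [] _ m = trans (treeCount-loop _≟_ ws z (Y m)) (trans (tc-X m) (rearrange (A + m * B)))
      where
      rearrange : ∀ a → a ≡ 1 * a + 0
      rearrange = solve-∀
    fan-at-terminal (v ∷ vs) fresh m = begin
      tc (v ∷ vs ++ ws) ((z , v) ∷ (c , v) ∷ fan c v vs z ++ Y m)
        ≡⟨ attach-spoked-fan fresh z∈ws m ⟩
      tc (vs ++ ws) ((c , z) ∷ fan c z vs z ++ Y m) + tc (v ∷ vs ++ ws) ((c , v) ∷ fan c v vs z ++ Y m)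
        -- Contracting `z v` turns the spoke of `v` into one more parallel edge `c z`, so the
        -- induction hypothesis is taken at `suc m`.
        ≡⟨ cong₂ _+_ (trans (treeCount-↭ _≟_ (vs ++ ws) (↭-sym (Perm.shift (c , z) (fan c z vs z) (Y m))))
                            (fan-at-terminal vs (tail-fresh fresh) (suc m)))
                     (fan-spoked v vs fresh m) ⟩
      (evenFib k * (A + (B + m * B)) + bridgeCount k * B) + (oddFib (suc k) * (A + m * B) + evenFib k * B)
        ≡⟨ rearrange (evenFib k) (bridgeCount k) (oddFib (suc k)) A B m ⟩
      (oddFib (suc k) + evenFib k) * (A + m * B) + (bridgeCount k + (evenFib k + evenFib k)) * B
        ≡⟨ cong (λ e → e * (A + m * B) + bridgeCount (suc k) * B) (evenFib-suc k) ⟨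
      evenFib (suc k) * (A + m * B) + bridgeCount (suc k) * B ∎
      where
      open ≡-Reasoning
      k = length vs
      rearrange : ∀ e t o A B m → (e * (A + (B + m * B)) + t * B) + (o * (A + m * B) + e * B)
                                ≡ (o + e) * (A + m * B) + (t + (e + e)) * B
      rearrange = solve-∀

-- Ladders: fans glued in parallel.

applyUpTo-+ : {A : Set} (f : ℕ → A) (m n : ℕ) → applyUpTo f (m + n) ≡ applyUpTo f m ++ applyUpTo (f ∘ (m +_)) n
applyUpTo-+ f zero    n = refl
applyUpTo-+ f (suc m) n = cong (f 0 ∷_) (applyUpTo-+ (f ∘ suc) m n)

-- Spokes and rim edges alternate, so that a ladder of r q steps cuts into r consecutive blocks, one
-- per fan.
ladder : {V : Set} → V → (ℕ → V) → ℕ → List (V × V)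
ladder c w zero    = []
ladder c w (suc n) = (c , w 0) ∷ (w 0 , w 1) ∷ ladder c (w ∘ suc) n

module _ {V : Set} (c : V) where

  ladder-+ : ∀ w m n → ladder c w (m + n) ≡ ladder c w m ++ ladder c (w ∘ (m +_)) n
  ladder-+ w zero    n = refl
  ladder-+ w (suc m) n = cong (λ es → (c , w 0) ∷ (w 0 , w 1) ∷ es) (ladder-+ (w ∘ suc) m n)

  ladder-fan : ∀ w k → ladder c w (suc k) ≡ (c , w 0) ∷ fan c (w 0) (applyUpTo (w ∘ suc) k) (w (suc k))
  ladder-fan w zero    = refl
  ladder-fan w (suc k) = cong (λ es → (c , w 0) ∷ (w 0 , w 1) ∷ es) (ladder-fan (w ∘ suc) k)

  ladder-All : {T : V → Set} → T c → ∀ w n → (∀ k → k ≤ n → T (w k)) →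
               All (λ e → T (proj₁ e) × T (proj₂ e)) (ladder c w n)
  ladder-All tc w zero    t = []
  ladder-All tc w (suc n) t = (tc , t 0 z≤n) ∷ (t 0 z≤n , t 1 (s≤s z≤n)) ∷
    ladder-All tc (w ∘ suc) n (λ k k≤n → t (suc k) (s≤s k≤n))

module _ {V : Set} (_≟_ : DecidableEquality V) (c z : V) (c≢z : c ≢ z) (d : ℕ) where

  private
    q : ℕ
    q = suc d

  -- The first summand has the new fan separating `c` from `z` and a tree on the rest. In the second
  -- the new fan, with its root edge, joins them and all the others separate them.
  fanTrees : ℕ → ℕ
  fanTrees zero    = 0
  fanTrees (suc r) = evenFib d * fanTrees r + (evenFib d + bridgeCount d) * evenFib d ^ r

  -- w lists the rim after collapsing, with period q between occurrences of z.
  record Rooted (w : ℕ → V) (r : ℕ) : Set where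
    field
      -- The bound includes `r`, since the last fan must also end at `z`.
      roots     : ∀ i → i ≤ r → w (i * q) ≡ z
      interior  : ∀ i j → i ℕ.< r → j ℕ.< d → w (i * q + suc j) ≢ z
      hub-fresh : ∀ k → w k ≢ c
      distinct  : ∀ {k l} → k ℕ.< r * q → l ℕ.< r * q → w k ≢ z → w k ≡ w l → k ≡ l

  rooted-shift : ∀ {w r} → Rooted w (suc r) → Rooted (w ∘ (q +_)) r
  rooted-shift {w} {r} rooted = record
    { roots     = λ i i≤r → roots (suc i) (s≤s i≤r)
    ; interior  = λ i j i<r j<d → subst (λ n → w n ≢ z) (+-assoc q (i * q) (suc j)) (interior (suc i) j (s≤s i<r) j<d)
    ; hub-fresh = λ k → hub-fresh (q + k)
    ; distinct  = λ k< l< w≢z eq → +-cancelˡ-≡ q _ _ (distinct (+-monoʳ-< q k<) (+-monoʳ-< q l<) w≢z eq)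
    }
    where open Rooted rooted

  -- The gluing starts with no fan at all, where A = 0 and B = 1.
  treeCount-parallel : ∀ m → treeCount _≟_ (c ∷ z ∷ []) (replicate m (c , z) ++ []) ≡ m
  treeCount-parallel zero    = treeCount-isolated _≟_ (here refl) (there (here refl)) (c≢z ∘ sym) []
  treeCount-parallel (suc m) = begin
    treeCount _≟_ (c ∷ z ∷ []) ((c , z) ∷ replicate m (c , z) ++ [])
      ≡⟨ treeCount-absorb _≟_ c≢z (c ∷ z ∷ []) (replicate m (c , z) ++ []) ⟩
    treeCount _≟_ (f c ∷ f z ∷ []) (mapEdges f (replicate m (c , z) ++ []))
      + treeCount _≟_ (c ∷ z ∷ []) (replicate m (c , z) ++ [])
      ≡⟨ cong₂ _+_
           (trans (cong₂ (λ x y → treeCount _≟_ (x ∷ y ∷ []) (mapEdges f (replicate m (c , z) ++ []))) fc fz) (loops m))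
           (treeCount-parallel m) ⟩
    1 + m ∎
    where
    open ≡-Reasoning
    f : V → V
    f = redirect _≟_ z c

    fc : f c ≡ c
    fc = redirect-miss _≟_ c≢z

    fz : f z ≡ c
    fz = redirect-hit _≟_ z c

    loops : ∀ m → treeCount _≟_ (c ∷ c ∷ []) (mapEdges f (replicate m (c , z) ++ [])) ≡ 1
    loops zero    = cong length (List.filter-accept (spanning? _≟_ (c ∷ c ∷ []))
      (acyclic-[] , (ε ∷ ε ∷ []) ∷ (ε ∷ ε ∷ []) ∷ []))
    loops (suc m) = trans
      (cong₂ (λ x y → treeCount _≟_ (c ∷ c ∷ []) ((x , y) ∷ mapEdges f (replicate m (c , z) ++ []))) fc fz)
      (trans (treeCount-loop _≟_ (c ∷ c ∷ []) c (mapEdges f (replicate m (c , z) ++ []))) (loops m))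

  -- Quantifying over `m` makes the induction hypothesis for the remaining fans exactly the linear
  -- law `tc-X` that `Fan` asks for.
  treeCount-ladder : ∀ r w → Rooted w r → ∀ m →
    treeCount _≟_ (applyUpTo w (r * q) ++ c ∷ z ∷ []) (replicate m (c , z) ++ ladder c w (r * q))
    ≡ fanTrees r + m * evenFib d ^ r
  treeCount-ladder zero    w _      m = trans (treeCount-parallel m) (sym (*-identityʳ m))
  treeCount-ladder (suc r) w rooted m = begin
    tc (applyUpTo w (q + n) ++ c ∷ z ∷ []) (replicate m (c , z) ++ ladder c w (q + n))
      ≡⟨ cong₂ (λ us E → tc us (replicate m (c , z) ++ E)) vertices≡ edges≡ ⟩
    tc (z ∷ vs ++ ws) (replicate m (c , z) ++ (c , z) ∷ fan c z vs z ++ X)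
      ≡⟨ treeCount-vertices _≟_ (λ { (here refl) → ∈-++⁺ʳ vs z∈ws ; (there p) → p }) there
           (replicate m (c , z) ++ (c , z) ∷ fan c z vs z ++ X) ⟩
    tc (vs ++ ws) (replicate m (c , z) ++ (c , z) ∷ fan c z vs z ++ X)
      ≡⟨ treeCount-↭ _≟_ (vs ++ ws) (Perm.trans (Perm.shift (c , z) (replicate m (c , z)) (fan c z vs z ++ X))
           (Perm.shifts (replicate (suc m) (c , z)) (fan c z vs z))) ⟩
    -- The root's own spoke has become one more edge `c z`, whence `suc m`.
    tc (vs ++ ws) (fan c z vs z ++ replicate (suc m) (c , z) ++ X)
      ≡⟨ Fan.fan-at-terminal _≟_ c z ws c∈ws z∈ws X X⊆ws (fanTrees r) (evenFib d ^ r)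
           (treeCount-ladder r w′ (rooted-shift rooted)) vs fresh (suc m) ⟩
    evenFib (length vs) * (fanTrees r + suc m * evenFib d ^ r) + bridgeCount (length vs) * evenFib d ^ r
      ≡⟨ cong (λ k → evenFib k * (fanTrees r + suc m * evenFib d ^ r) + bridgeCount k * evenFib d ^ r)
           (List.length-applyUpTo (w ∘ suc) d) ⟩
    evenFib d * (fanTrees r + suc m * evenFib d ^ r) + bridgeCount d * evenFib d ^ r
      ≡⟨ rearrange (evenFib d) (fanTrees r) m (evenFib d ^ r) (bridgeCount d) ⟩
    fanTrees (suc r) + m * evenFib d ^ suc r ∎
    where
    open ≡-Reasoning
    open Rooted rooted

    tc : List V → List (V × V) → ℕ
    tc = treeCount _≟_

    n : ℕ
    n = r * q

    w′ : ℕ → V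
    w′ = w ∘ (q +_)

    vs ws : List V
    vs = applyUpTo (w ∘ suc) d
    ws = applyUpTo w′ n ++ c ∷ z ∷ []

    X : List (V × V)
    X = ladder c w′ n

    c∈ws : c ∈ ws
    c∈ws = ∈-++⁺ʳ (applyUpTo w′ n) (here refl)

    z∈ws : z ∈ ws
    z∈ws = ∈-++⁺ʳ (applyUpTo w′ n) (there (here refl))

    w0≡z : w 0 ≡ z
    w0≡z = roots 0 z≤n

    vertices≡ : applyUpTo w (q + n) ++ c ∷ z ∷ [] ≡ z ∷ vs ++ ws
    vertices≡ = cong₂ _∷_ w0≡z
      (trans (cong (_++ c ∷ z ∷ []) (applyUpTo-+ (w ∘ suc) d n)) (List.++-assoc vs (applyUpTo w′ n) (c ∷ z ∷ [])))

    edges≡ : ladder c w (q + n) ≡ (c , z) ∷ fan c z vs z ++ X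
    edges≡ = begin
      ladder c w (q + n)
        ≡⟨ ladder-+ c w q n ⟩
      ladder c w q ++ X
        ≡⟨ cong (_++ X) (ladder-fan c w d) ⟩
      (c , w 0) ∷ fan c (w 0) vs (w q) ++ X
        ≡⟨ cong₂ (λ x y → (c , x) ∷ fan c x vs y ++ X) w0≡z
             (trans (cong w (sym (*-identityˡ q))) (roots 1 (s≤s z≤n))) ⟩
      (c , z) ∷ fan c z vs z ++ X ∎

    X⊆ws : All (λ e → proj₁ e ∈ ws × proj₂ e ∈ ws) X
    X⊆ws = ladder-All c c∈ws w′ n within
      where
      within : ∀ k → k ≤ n → w′ k ∈ ws
      within k k≤n with m≤n⇒m<n∨m≡n k≤n
      ... | inj₁ k<n  = ∈-++⁺ˡ (∈-applyUpTo⁺ w′ k<n)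
      -- The last rim edge ends one position past the listed vertices, at a root, which is `z`.
      ... | inj₂ refl = subst (_∈ ws) (sym (roots (suc r) ≤-refl)) z∈ws

    interior₀ : ∀ {j} → j ℕ.< d → w (suc j) ≢ z
    interior₀ = interior 0 _ (s≤s z≤n)

    bound : ∀ {j} → j ℕ.< d → suc j ℕ.< q + n
    bound j<d = <-≤-trans (s≤s j<d) (m≤m+n q n)

    fresh : Unique vs × All (_∉ ws) vs
    fresh =
      Unique.applyUpTo⁺₁ (w ∘ suc) d (λ i<j j<d eq →
        <⇒≢ i<j (suc-injective (distinct (bound (<-trans i<j j<d)) (bound j<d) (interior₀ (<-trans i<j j<d)) eq))) ,
      All.applyUpTo⁺₁ (w ∘ suc) d outside
      where
      outside : ∀ {j} → j ℕ.< d → w (suc j) ∉ ws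
      outside {j} j<d p with ∈-++⁻ (applyUpTo w′ n) p
      ... | inj₂ (here eq)         = hub-fresh (suc j) eq
      ... | inj₂ (there (here eq)) = interior₀ j<d eq
      ... | inj₁ p′ with ∈-applyUpTo⁻ w′ p′
      -- Distinctness gives `suc j ≡ q + l`, that is `j ≡ d + l`, against `j < d`.
      ... | l , l<n , eq = m+n≮m d l
        (subst (ℕ._< d) (suc-injective (distinct (bound j<d) (+-monoʳ-< q l<n) (interior₀ j<d) eq)) j<d)

    rearrange : ∀ e f m p b → e * (f + (p + m * p)) + b * p ≡ (e * f + (e + b) * p) + m * (e * p)
    rearrange = solve-∀

  fanTrees-closed : ∀ r → fanTrees (suc r) ≡ suc r * (evenFib d + bridgeCount d) * evenFib d ^ r
  fanTrees-closed zero    = base (evenFib d) (evenFib d + bridgeCount d)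
    where
    base : ∀ e t → e * 0 + t * 1 ≡ 1 * t * 1
    base = solve-∀
  fanTrees-closed (suc r) = begin
    evenFib d * fanTrees (suc r) + T * evenFib d ^ suc r
      ≡⟨ cong (λ f → evenFib d * f + T * evenFib d ^ suc r) (fanTrees-closed r) ⟩
    evenFib d * (suc r * T * evenFib d ^ r) + T * evenFib d ^ suc r
      ≡⟨ step (evenFib d) T (suc r) (evenFib d ^ r) ⟩
    suc (suc r) * T * evenFib d ^ suc r ∎
    where
    open ≡-Reasoning
    T : ℕ
    T = evenFib d + bridgeCount d
    step : ∀ e t s p → e * (s * t * p) + t * (e * p) ≡ (t + s * t) * (e * p)
    step = solve-∀

-- Rooted forests of G and spanning trees of G / R.

module _ (G : Multigraph) (R : List (Multigraph.Vertex G)) where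
  open Multigraph G
  open Identify G R
  open DecMembership _≟_ using (_∈?_; _∉?_)

  collapse-root : ∀ {v} → v ∈ R → collapse v ≡ nothing
  collapse-root {v} v∈R with v ∈? R
  ... | yes _  = refl
  ... | no v∉R = contradiction v∈R v∉R

  collapse-other : ∀ {v} → v ∉ R → collapse v ≡ just v
  collapse-other {v} v∉R with v ∈? R
  ... | yes v∈R = contradiction v∈R v∉R
  ... | no _    = refl

  collapse-≡ : ∀ u v → collapse u ≡ collapse v → u ≡ v ⊎ (u ∈ R × v ∈ R)
  collapse-≡ u v eq with u ∈? R | v ∈? R
  collapse-≡ u v eq   | yes u∈ | yes v∈ = inj₂ (u∈ , v∈)
  collapse-≡ u v refl | no _   | no _   = inj₁ refl

  Grounded : List (Vertex × Vertex) → Vertex → Set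
  Grounded es v = ∃ λ r → r ∈ R × Connected es v r

  connected-collapse⁺ : ∀ {es x y} → Connected es x y → Connected (mapEdges collapse es) (collapse x) (collapse y)
  connected-collapse⁺ = EqClosure.gmap collapse (∈-map⁺ _)

  grounded⇒connected : ∀ {es v} → Grounded es v → Connected (mapEdges collapse es) (collapse v) nothing
  grounded⇒connected (r , r∈R , c) = subst (Connected _ _) (collapse-root r∈R) (connected-collapse⁺ c)

  -- A walk in the quotient lifts unless it jumps between two roots at the merged vertex, and then
  -- both of its ends reach roots. Arbitrary preimages of `p` and `q` are allowed because `nothing`
  -- may have several.
  connected-collapse⁻ : ∀ {es p q} → Connected (mapEdges collapse es) p q →
                        ∀ {x y} → collapse x ≡ p → collapse y ≡ q →
                        Connected es x y ⊎ (Grounded es x × Grounded es y)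
  connected-collapse⁻ {es} = go
    where
    Joined : Vertex → Vertex → Set
    Joined x y = Connected es x y ⊎ (Grounded es x × Grounded es y)

    step : ∀ {x u v y} → collapse x ≡ collapse u → Connected es u v → Joined v y → Joined x y
    step {x} {u} eq uv vy with collapse-≡ x u eq | vy
    ... | inj₁ refl | inj₁ c                      = inj₁ (uv ◅◅ c)
    ... | inj₁ refl | inj₂ ((r , r∈ , c) , gy)    = inj₂ ((r , r∈ , uv ◅◅ c) , gy)
    ... | inj₂ (x∈ , u∈) | inj₁ c                 = inj₂ ((x , x∈ , ε) , (u , u∈ , connected-sym (uv ◅◅ c)))
    ... | inj₂ (x∈ , u∈) | inj₂ (_ , gy)          = inj₂ ((x , x∈ , ε) , gy)

    go : ∀ {p q} → Connected (mapEdges collapse es) p q → ∀ {x y} → collapse x ≡ p → collapse y ≡ q → Joined x y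
    go ε {x} {y} refl eq with collapse-≡ x y (sym eq)
    ... | inj₁ refl      = inj₁ ε
    ... | inj₂ (x∈ , y∈) = inj₂ ((x , x∈ , ε) , (y , y∈ , ε))
    go (fwd m ◅ c) eq eq′ with ∈-map⁻ _ m
    ... | (u , v) , m′ , refl = step eq (fwd m′ ◅ ε) (go c refl eq′)
    go (bwd m ◅ c) eq eq′ with ∈-map⁻ _ m
    ... | (u , v) , m′ , refl = step eq (bwd m′ ◅ ε) (go c refl eq′)

  RootsSeparated : List (Vertex × Vertex) → Set
  RootsSeparated es = ∀ {r s} → r ∈ R → s ∈ R → Connected es r s → r ≡ s

  -- If collapsing an edge `a b` closed a cycle although `a` and `b` are apart in `es`, both would
  -- reach roots. The edge joins these roots, so they coincide, and `a`, `b` were connected after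
  -- all.
  acyclic-collapse⁺ : ∀ es → Acyclic es → RootsSeparated es → Acyclic (mapEdges collapse es)
  acyclic-collapse⁺ []             _  _   = acyclic-[]
  acyclic-collapse⁺ ((a , b) ∷ es) ac sep = acyclic-∷⁺ (collapse a) (collapse b) _ separate
    (acyclic-collapse⁺ es (acyclic-tail a b es ac) (λ r∈ s∈ c → sep r∈ s∈ (connected-⊆ there c)))
    where
    separate : ¬ Connected (mapEdges collapse es) (collapse a) (collapse b)
    separate c with connected-collapse⁻ c refl refl
    ... | inj₁ ab = acyclic-head _≟_ a b es ac ab
    ... | inj₂ ((r , r∈ , ar) , (s , s∈ , bs))
      with sep r∈ s∈ (connected-through (inj₁ (connected-sym ar , bs)))
    ... | refl = acyclic-head _≟_ a b es ac (ar ◅◅ connected-sym bs)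

  -- An edge that newly joins two roots has both ends grounded in `es`. Both ends are then connected
  -- to `nothing` in the quotient, where the edge would close a cycle.
  acyclic-collapse⁻ : ∀ es → Acyclic (mapEdges collapse es) → Acyclic es × RootsSeparated es
  acyclic-collapse⁻ []             _  = acyclic-[] , λ _ _ → connected-[]
  acyclic-collapse⁻ ((a , b) ∷ es) ac =
    acyclic-∷⁺ a b es (separate ∘ connected-collapse⁺) (proj₁ ih) , roots-separated
    where
    ih : Acyclic es × RootsSeparated es
    ih = acyclic-collapse⁻ es (acyclic-tail (collapse a) (collapse b) _ ac)

    separate : ¬ Connected (mapEdges collapse es) (collapse a) (collapse b)
    separate = acyclic-head _≟′_ (collapse a) (collapse b) _ ac

    not-both-grounded : Grounded es a → ¬ Grounded es b
    not-both-grounded ga gb = separate (grounded⇒connected ga ◅◅ connected-sym (grounded⇒connected gb))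

    roots-separated : RootsSeparated ((a , b) ∷ es)
    roots-separated {r} {s} r∈ s∈ c with connected-∷⁻ c
    ... | inj₁ c′ = proj₂ ih r∈ s∈ c′
    ... | inj₂ (inj₁ (ra , bs)) =
      contradiction (s , s∈ , bs) (not-both-grounded (r , r∈ , connected-sym ra))
    ... | inj₂ (inj₂ (rb , as)) =
      contradiction (r , r∈ , connected-sym rb) (not-both-grounded (s , s∈ , as))

  module _ {r₀ : Vertex} (r₀∈R : r₀ ∈ R) (R⊆vertices : ∀ {r} → r ∈ R → r ∈ vertices) where

    forest⇒spanning : ∀ es → IsRootedSpanningForest G R es →
                      Spanning _≟′_ (map collapse vertices) (mapEdges collapse es)
    forest⇒spanning es (ac , unique-root) =
      acyclic-collapse⁺ es ac sep ,
      All.map⁺ (All.map (λ gu → All.map⁺ (All.map (λ gv → gu ◅◅ connected-sym gv) grounded)) grounded)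
      where
      grounded : All (λ v → Connected (mapEdges collapse es) (collapse v) nothing) vertices
      grounded = All.map (λ (r , (r∈ , c) , _) → grounded⇒connected (r , r∈ , c)) unique-root

      sep : RootsSeparated es
      sep r∈ s∈ c = let _ , _ , unique = All.lookup unique-root (R⊆vertices r∈) in
        trans (sym (unique (r∈ , ε))) (unique (s∈ , c))

    spanning⇒forest : ∀ es → Spanning _≟′_ (map collapse vertices) (mapEdges collapse es) →
                      IsRootedSpanningForest G R es
    spanning⇒forest es (ac , conn) = proj₁ ac⁻ , All.tabulate (unique-root ∘ grounded)
      where
      ac⁻ : Acyclic es × RootsSeparated es
      ac⁻ = acyclic-collapse⁻ es ac

      grounded : ∀ {v} → v ∈ vertices → Grounded es v
      grounded v∈ with connected-collapse⁻
        (All.lookup (All.lookup conn (∈-map⁺ collapse v∈)) (∈-map⁺ collapse (R⊆vertices r₀∈R))) refl refl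
      ... | inj₁ c        = r₀ , r₀∈R , c
      ... | inj₂ (gv , _) = gv

      unique-root : ∀ {v} → Grounded es v → ∃! _≡_ (λ r → r ∈ R × Connected es v r)
      unique-root (r , r∈ , c) = r , (r∈ , c) , λ (s∈ , c′) → proj₂ ac⁻ r∈ s∈ (connected-sym c ◅◅ c′)

    -- The common value of `𝓕` and `τ` is taken on the quotient with its loops kept, so that edge
    -- sets of G and of the quotient correspond by position. Removing the loops affects only
    -- `τ-collapse`.
    𝓕-collapse : 𝓕 G R ≡ treeCount _≟′_ (map collapse vertices) (mapEdges collapse edges)
    𝓕-collapse = trans
      (count-cong (isRootedSpanningForest? G R) (spanning? _≟′_ (map collapse vertices) ∘ mapEdges collapse)
        forest⇒spanning spanning⇒forest edges)
      (sym (count-map (spanning? _≟′_ (map collapse vertices)) (Product.map collapse collapse) edges))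

    τ-collapse : τ (G / R) ≡ treeCount _≟′_ (map collapse vertices) (mapEdges collapse edges)
    τ-collapse = trans
      (treeCount-filter-loops _≟′_ vertices′ (λ e → ¬? (proj₁ e ≟′ proj₂ e)) (mapEdges collapse edges))
      (treeCount-vertices _≟′_ to from (mapEdges collapse edges))
      where
      to : ∀ {v} → v ∈ vertices′ → v ∈ map collapse vertices
      to (here refl) = subst (_∈ map collapse vertices) (collapse-root r₀∈R) (∈-map⁺ collapse (R⊆vertices r₀∈R))
      to (there m) with ∈-map⁻ just m
      ... | v , m′ , refl with ∈-filter⁻ (_∉? R) {xs = vertices} m′
      ... | v∈ , v∉R = subst (_∈ map collapse vertices) (collapse-other v∉R) (∈-map⁺ collapse v∈)

      from : ∀ {v} → v ∈ map collapse vertices → v ∈ vertices′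
      from m with ∈-map⁻ collapse m
      ... | v , v∈ , refl = collapse-∈ v∈

    𝓕≡τ : 𝓕 G R ≡ τ (G / R)
    𝓕≡τ = trans 𝓕-collapse (sym τ-collapse)

-- Rotation, residues and equal spacing.

applyUpTo-rotate : {A : Set} (f : ℕ → A) (n : ℕ) → (∀ k → f (k + n) ≡ f k) →
                   ∀ a → applyUpTo f n ↭ applyUpTo (f ∘ (a +_)) n
applyUpTo-rotate f zero    periodic a       = Perm.refl
applyUpTo-rotate f (suc n) periodic zero    = Perm.refl
applyUpTo-rotate f (suc n) periodic (suc a) = Perm.trans rotate₁ (applyUpTo-rotate (f ∘ suc) (suc n) (periodic ∘ suc) a)
  where
  rotate₁ : f 0 ∷ applyUpTo (f ∘ suc) n ↭ applyUpTo (f ∘ suc) (suc n)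
  rotate₁ = Perm.trans (Perm.∷↭∷ʳ (f 0) (applyUpTo (f ∘ suc) n))
    (↭-reflexive (trans (cong (λ x → applyUpTo (f ∘ suc) n ++ x ∷ []) (sym (periodic 0))) (List.applyUpTo-∷ʳ (f ∘ suc) n)))

applyUpTo-cong : {A : Set} {f g : ℕ → A} → (∀ k → f k ≡ g k) → ∀ n → applyUpTo f n ≡ applyUpTo g n
applyUpTo-cong eq zero    = refl
applyUpTo-cong eq (suc n) = cong₂ _∷_ (eq 0) (applyUpTo-cong (eq ∘ suc) n)

tabulate-toℕ : {A : Set} (f : ℕ → A) (n : ℕ) → tabulate {n = n} (f ∘ toℕ) ≡ applyUpTo f n
tabulate-toℕ f zero    = refl
tabulate-toℕ f (suc n) = cong (f 0 ∷_) (tabulate-toℕ (f ∘ suc) n)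

ladder-↭ : {V : Set} (c : V) (w : ℕ → V) (n : ℕ) →
           applyUpTo (λ k → w k , w (suc k)) n ++ applyUpTo (λ k → c , w k) n ↭ ladder c w n
ladder-↭ c w zero    = Perm.refl
ladder-↭ c w (suc n) = Perm.trans
  (Perm.shift (c , w 0) (applyUpTo (λ k → w k , w (suc k)) (suc n)) (applyUpTo (λ k → c , w (suc k)) n))
  (Perm.prep _ (Perm.prep _ (ladder-↭ c (w ∘ suc) n)))

mapEdges-ladder : {V W : Set} (f : V → W) (c : V) (w : ℕ → V) (n : ℕ) →
                  mapEdges f (ladder c w n) ≡ ladder (f c) (f ∘ w) n
mapEdges-ladder f c w zero    = refl
mapEdges-ladder f c w (suc n) = cong (λ es → (f c , f (w 0)) ∷ (f (w 0) , f (w 1)) ∷ es) (mapEdges-ladder f c (w ∘ suc) n)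

-- Equal remainders make the difference of the two offsets a multiple of `N`; being smaller than
-- `N`, it vanishes.
[m+n]%-injective : ∀ N .{{_ : NonZero N}} a {k l} → k ℕ.< N → l ℕ.< N → (a + k) % N ≡ (a + l) % N → k ≡ l
[m+n]%-injective N a k<N l<N eq =
  [ (λ k≤l → ordered k≤l l<N eq) , (λ l≤k → sym (ordered l≤k k<N (sym eq))) ]′ (≤-total _ _)
  where
  ordered : ∀ {k l} → k ≤ l → l ℕ.< N → (a + k) % N ≡ (a + l) % N → k ≡ l
  ordered {k} k≤l l<N eq with m≤n⇒∃[o]m+o≡n k≤l
  ... | e , refl = trans (sym (+-identityʳ k)) (cong (k +_) (sym e≡0))
    where
    open ≡-Reasoning
    x = a + k
    e-multiple : e ≡ ((x + e) DivMod./ N ∸ x DivMod./ N) * N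
    e-multiple = begin
      e
        ≡⟨ m+n∸m≡n x e ⟨
      (x + e) ∸ x
        ≡⟨ cong₂ _∸_ (DivMod.m≡m%n+[m/n]*n (x + e) N) (DivMod.m≡m%n+[m/n]*n x N) ⟩
      ((x + e) % N + (x + e) DivMod./ N * N) ∸ (x % N + x DivMod./ N * N)
        ≡⟨ cong (λ r → (r + (x + e) DivMod./ N * N) ∸ (x % N + x DivMod./ N * N))
             (trans (cong (_% N) (+-assoc a k e)) (sym eq)) ⟩
      (x % N + (x + e) DivMod./ N * N) ∸ (x % N + x DivMod./ N * N)
        ≡⟨ [m+n]∸[m+o]≡n∸o (x % N) _ _ ⟩
      (x + e) DivMod./ N * N ∸ x DivMod./ N * N
        ≡⟨ *-distribʳ-∸ N ((x + e) DivMod./ N) (x DivMod./ N) ⟨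
      ((x + e) DivMod./ N ∸ x DivMod./ N) * N ∎
    e≡0 : e ≡ 0
    e≡0 = trans (sym (DivMod.m<n⇒m%n≡m (≤-<-trans (m≤n+m e k) l<N)))
      (trans (cong (_% N) e-multiple) (DivMod.m*n%n≡0 ((x + e) DivMod./ N ∸ x DivMod./ N) N))

-- A positive difference shows that the subtraction did not truncate.
gap : ∀ {m n k} → 1 ≤ k → m ∸ n ≡ k → m ≡ n + k
gap {m} {n} 1≤k eq with ≤-total n m
... | inj₁ n≤m = trans (sym (m∸n+n≡m n≤m)) (trans (cong (_+ n) eq) (+-comm _ n))
... | inj₂ m≤n with trans (sym (m≤n⇒m∸n≡0 m≤n)) eq
gap (s≤s _) eq | inj₂ _ | ()

equal-steps : ∀ {k} (b : Fin (suc k) → ℕ) q → (∀ j → b (suc j) ≡ b (inject₁ j) + q) →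
              ∀ i → b i ≡ b zero + toℕ i * q
equal-steps b q step zero = sym (+-identityʳ _)
equal-steps {suc k} b q step (suc i) =
  trans (equal-steps (b ∘ suc) q (step ∘ suc) i)
    (trans (cong (_+ toℕ i * q) (step zero)) (+-assoc (b zero) q (toℕ i * q)))

roots-equally-spaced : ∀ {N k q} (a : Fin (suc k) → Fin N) → 1 ≤ q → (∀ i → cyclicInterval a i ≡ q) →
                       ∀ i → toℕ (a i) ≡ toℕ (a zero) + toℕ i * q
roots-equally-spaced {N} {k} {q} a 1≤q intervals = equal-steps (toℕ ∘ a) q step
  where
  interval : ∀ j → cyclicInterval a (inject₁ j) ≡ toℕ (a (suc j)) ∸ toℕ (a (inject₁ j))
  interval j rewrite view-inject₁ j = refl

  step : ∀ j → toℕ (a (suc j)) ≡ toℕ (a (inject₁ j)) + q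
  step j = gap 1≤q (trans (sym (interval j)) (intervals (inject₁ j)))

-- The wheel with equally spaced roots.

module EquallySpaced (n r d : ℕ) (N≡rq : suc n ≡ suc r * suc d) (a : Fin (suc r) → Fin (suc n))
                     (spaced : ∀ i → toℕ (a i) ≡ toℕ (a zero) + toℕ i * suc d) where

  private
    N q a₀ : ℕ
    N = suc n
    q = suc d
    a₀ = toℕ (a zero)

    G : Multigraph
    G = wheel N

    R : List (WheelVertex N)
    R = rimSet a

  open Multigraph G using (vertices; edges)
  open Identify G R using (collapse)

  rimAt : ℕ → WheelVertex N
  rimAt k = rim (k mod N)

  toℕ-mod : ∀ k → toℕ (k mod N) ≡ k % N
  toℕ-mod k = Fin.toℕ-fromℕ< (DivMod.m%n<n k N)

  mod-toℕ : ∀ (i : Fin N) → toℕ i mod N ≡ i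
  mod-toℕ i = Fin.toℕ-injective (trans (toℕ-mod (toℕ i)) (DivMod.m<n⇒m%n≡m (Fin.toℕ<n i)))

  rimAt-periodic : ∀ k → rimAt (k + N) ≡ rimAt k
  rimAt-periodic k = cong rim (Fin.toℕ-injective
    (trans (toℕ-mod (k + N)) (trans (DivMod.[m+n]%n≡m%n k N) (sym (toℕ-mod k)))))

  -- Counting from the first root puts the roots at the multiples of q, as `Rooted` expects.
  rimFrom : ℕ → WheelVertex N
  rimFrom k = rimAt (a₀ + k)

  rimFrom-injective : ∀ {k l} → k ℕ.< N → l ℕ.< N → rimFrom k ≡ rimFrom l → k ≡ l
  rimFrom-injective {k} {l} k<N l<N eq = [m+n]%-injective N a₀ k<N l<N
    (trans (sym (toℕ-mod (a₀ + k))) (trans (cong toℕ (rim-injective eq)) (toℕ-mod (a₀ + l))))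

  root≡ : ∀ i → rimFrom (toℕ i * q) ≡ rim (a i)
  root≡ i = cong rim (trans (cong (_mod N) (sym (spaced i))) (mod-toℕ (a i)))

  marked : ∀ i → rim (a i) ∈ R
  marked = ∈-tabulate⁺ {f = rim ∘ a}

  marked⁻ : ∀ {v} → v ∈ R → ∃ λ i → v ≡ rim (a i)
  marked⁻ = ∈-tabulate⁻ {f = rim ∘ a}

  root-∈ : ∀ i → i ≤ suc r → rimFrom (i * q) ∈ R
  root-∈ i i≤ with m≤n⇒m<n∨m≡n i≤
  ... | inj₁ i<   = subst (_∈ R)
    (trans (sym (root≡ (fromℕ< i<))) (cong (λ k → rimFrom (k * q)) (Fin.toℕ-fromℕ< i<)))
    (marked (fromℕ< i<))
  -- After `suc r` steps of length q, a full turn, the first root comes round again.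
  ... | inj₂ refl = subst (_∈ R)
    (sym (trans (cong (λ k → rimAt (a₀ + k)) (sym N≡rq)) (trans (rimAt-periodic a₀) (cong rim (mod-toℕ (a zero))))))
    (marked zero)

  -- All roots sit at multiples of q, so reducing positions modulo q would give `suc j ≡ 0`.
  interior-∉ : ∀ i j → i ℕ.< suc r → j ℕ.< d → rimFrom (i * q + suc j) ∉ R
  interior-∉ i j i< j<d m with marked⁻ m
  ... | i′ , eq with begin
      suc j                     ≡⟨ DivMod.m<n⇒m%n≡m (s≤s j<d) ⟨
      suc j % q                 ≡⟨ DivMod.[m+kn]%n≡m%n (suc j) i q ⟨
      (suc j + i * q) % q       ≡⟨ cong (_% q) (trans (+-comm (suc j) (i * q)) positions≡) ⟩
      (toℕ i′ * q) % q          ≡⟨ DivMod.m*n%n≡0 (toℕ i′) q ⟩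
      0                         ∎
    where
    open ≡-Reasoning
    positions≡ : i * q + suc j ≡ toℕ i′ * q
    positions≡ = rimFrom-injective
      (subst (i * q + suc j ℕ.<_) (sym N≡rq) (<-≤-trans (+-monoʳ-< (i * q) (s≤s j<d))
        (subst (_≤ suc r * q) (+-comm q (i * q)) (*-monoˡ-≤ q i<))))
      (subst (toℕ i′ * q ℕ.<_) (sym N≡rq) (*-monoˡ-< q (Fin.toℕ<n i′)))
      (trans eq (sym (root≡ i′)))
  ... | ()

  centre-∉ : centre ∉ R
  centre-∉ m with marked⁻ m
  ... | _ , ()

  collapse-nothing : ∀ v → collapse v ≡ nothing → v ∈ R
  collapse-nothing v eq with collapse-≡ G R v (rim (a zero)) (trans eq (sym (collapse-root G R (marked zero))))
  ... | inj₁ refl     = marked zero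
  ... | inj₂ (v∈ , _) = v∈

  label : ℕ → Maybe (WheelVertex N)
  label k = collapse (rimFrom k)

  rooted : Rooted (Identify._≟′_ G R) (just centre) nothing (λ ()) d label (suc r)
  rooted = record
    { roots     = λ i i≤ → collapse-root G R (root-∈ i i≤)
    ; interior  = λ i j i< j<d eq → interior-∉ i j i< j<d (collapse-nothing _ eq)
    ; hub-fresh = λ k → hub-fresh (rimFrom k) (λ ())
    ; distinct  = λ {k} {l} k< l< ≢z eq → distinct k l (subst (k ℕ.<_) (sym N≡rq) k<) (subst (l ℕ.<_) (sym N≡rq) l<) ≢z eq
    }
    where
    hub-fresh : ∀ v → v ≢ centre → collapse v ≢ just centre
    hub-fresh v v≢c eq with collapse-≡ G R v centre (trans eq (sym (collapse-other G R centre-∉)))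
    ... | inj₁ v≡c      = v≢c v≡c
    ... | inj₂ (_ , c∈) = centre-∉ c∈

    distinct : ∀ k l → k ℕ.< N → l ℕ.< N → label k ≢ nothing → label k ≡ label l → k ≡ l
    distinct k l k< l< ≢z eq with collapse-≡ G R (rimFrom k) (rimFrom l) eq
    ... | inj₁ eq′      = rimFrom-injective k< l< eq′
    ... | inj₂ (k∈ , _) = contradiction (collapse-root G R k∈) ≢z

  edges-↭ : edges ↭ ladder centre rimFrom N
  edges-↭ = Perm.trans (↭-reflexive (cong₂ _++_ rims spokes))
    (Perm.trans (Perm.++⁺ (subst (applyUpTo side N ↭_) (applyUpTo-cong shift N)
                            (applyUpTo-rotate side N side-periodic a₀))
                          (applyUpTo-rotate spoke N (cong (centre ,_) ∘ rimAt-periodic) a₀))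
      (ladder-↭ centre rimFrom N))
    where
    side spoke : ℕ → WheelVertex N × WheelVertex N
    side  k = rimAt k , rimAt (suc k)
    spoke k = centre , rimAt k

    side-periodic : ∀ k → side (k + N) ≡ side k
    side-periodic k = cong₂ _,_ (rimAt-periodic k) (rimAt-periodic (suc k))

    shift : ∀ k → side (a₀ + k) ≡ (rimFrom k , rimFrom (suc k))
    shift k = cong (λ m → rimFrom k , rimAt m) (sym (+-suc a₀ k))

    rims : tabulate (λ i → rim i , rim (next i)) ≡ applyUpTo side N
    -- `next i` unfolds to `suc (toℕ i) mod N`, so only the first endpoint has to be rewritten.
    rims = trans (List.tabulate-cong (λ i → cong (λ j → rim j , rim (next i)) (sym (mod-toℕ i)))) (tabulate-toℕ side N)

    spokes : tabulate (λ i → centre , rim i) ≡ applyUpTo spoke N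
    spokes = trans (List.tabulate-cong (λ i → cong (λ j → centre , rim j) (sym (mod-toℕ i)))) (tabulate-toℕ spoke N)

  vertices-↭ : vertices ↭ centre ∷ applyUpTo rimFrom N
  vertices-↭ = Perm.prep centre (Perm.trans
    (↭-reflexive (trans (List.map-tabulate id rim)
      (trans (List.tabulate-cong (λ i → cong rim (sym (mod-toℕ i)))) (tabulate-toℕ rimAt N))))
    (applyUpTo-rotate rimAt N rimAt-periodic a₀))

  treeCount-collapse : treeCount (Identify._≟′_ G R) (map collapse vertices) (mapEdges collapse edges) ≡
                       suc r * (evenFib d + bridgeCount d) * evenFib d ^ r
  treeCount-collapse = begin
    tc (map collapse vertices) (mapEdges collapse edges)
      ≡⟨ treeCount-↭ _≟′_ (map collapse vertices) (Perm.map⁺ _ edges-↭) ⟩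
    tc (map collapse vertices) (mapEdges collapse (ladder centre rimFrom N))
      ≡⟨ cong (tc (map collapse vertices)) (trans (mapEdges-ladder collapse centre rimFrom N)
           (cong (λ c → ladder c label N) (collapse-other G R centre-∉))) ⟩
    tc (map collapse vertices) (ladder (just centre) label N)
      ≡⟨ treeCount-vertices _≟′_ to from (ladder (just centre) label N) ⟩
    tc (applyUpTo label N ++ just centre ∷ nothing ∷ []) (ladder (just centre) label N)
      ≡⟨ cong (λ m → tc (applyUpTo label m ++ just centre ∷ nothing ∷ []) (ladder (just centre) label m)) N≡rq ⟩
    tc (applyUpTo label (suc r * q) ++ just centre ∷ nothing ∷ []) (ladder (just centre) label (suc r * q))
      -- No extra edges `c z` are added to the whole wheel, hence `m = 0`.
      ≡⟨ treeCount-ladder _≟′_ (just centre) nothing (λ ()) d (suc r) label rooted 0 ⟩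
    fanTrees _≟′_ (just centre) nothing (λ ()) d (suc r) + 0
      ≡⟨ +-identityʳ _ ⟩
    fanTrees _≟′_ (just centre) nothing (λ ()) d (suc r)
      ≡⟨ fanTrees-closed _≟′_ (just centre) nothing (λ ()) d r ⟩
    suc r * (evenFib d + bridgeCount d) * evenFib d ^ r ∎
    where
    open ≡-Reasoning
    open Identify G R using (_≟′_)

    tc : List (Maybe (WheelVertex N)) → List (Maybe (WheelVertex N) × Maybe (WheelVertex N)) → ℕ
    tc = treeCount _≟′_

    collapsed↭ : map collapse vertices ↭ just centre ∷ applyUpTo label N
    collapsed↭ = Perm.trans (Perm.map⁺ collapse vertices-↭)
      (↭-reflexive (cong₂ _∷_ (collapse-other G R centre-∉) (List.map-applyUpTo rimFrom collapse N)))

    to : ∀ {v} → v ∈ map collapse vertices → v ∈ applyUpTo label N ++ just centre ∷ nothing ∷ []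
    to m with Perm.∈-resp-↭ collapsed↭ m
    ... | here refl = ∈-++⁺ʳ (applyUpTo label N) (here refl)
    ... | there m′  = ∈-++⁺ˡ m′

    from : ∀ {v} → v ∈ applyUpTo label N ++ just centre ∷ nothing ∷ [] → v ∈ map collapse vertices
    from m with ∈-++⁻ (applyUpTo label N) m
    ... | inj₁ m′                  = Perm.∈-resp-↭ (↭-sym collapsed↭) (there m′)
    ... | inj₂ (here refl)         = Perm.∈-resp-↭ (↭-sym collapsed↭) (here refl)
    -- The merged vertex is already the label at position 0, the first root.
    ... | inj₂ (there (here refl)) = Perm.∈-resp-↭ (↭-sym collapsed↭)
      (there (subst (_∈ applyUpTo label N) (collapse-root G R (root-∈ 0 z≤n)) (∈-applyUpTo⁺ label (s≤s z≤n))))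

  R⊆vertices : ∀ {v} → v ∈ R → v ∈ vertices
  R⊆vertices m with marked⁻ m
  ... | i , refl = there (∈-map⁺ rim (∈-allFin (a i)))

corollary3p3 : (N r q : ℕ) → 3 ≤ N → 1 ≤ r → 1 ≤ q → N ≡ r * q →
    (a : Fin r → Fin N) → Monotonic₁ _<_ _<_ a →
    (∀ i → cyclicInterval a i ≡ q) →
    𝓕 (wheel N) (rimSet a) ≡ τ (wheel N / rimSet a) ×
    τ (wheel N / rimSet a) ≡ r * (lucas (2 * q) ∸ 2) * fib (2 * q) ^ (r ∸ 1)
corollary3p3 (suc n) (suc r) (suc d) _ _ _ N≡rq a _ intervals =
  𝓕≡τ G R (marked zero) R⊆vertices ,
  trans (τ-collapse G R (marked zero) R⊆vertices)
    (trans treeCount-collapse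
      (cong₂ (λ t s → suc r * t * s ^ r)
        -- The identity has the form `2 + x`, from which `∸ 2` computes to `x` without truncation.
        (sym (cong (_∸ 2) (lucas-bridgeCount d)))
        (cong fib (sym (*-suc 2 d)))))
  where
  open EquallySpaced n r d N≡rq a (roots-equally-spaced a (s≤s z≤n) intervals)
  G = wheel (suc n)
  R = rimSet a
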